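{- Let $G$ be a Jposy-graph. Then every vertex $v$ of $G$ belongs to an $M$-Tposy of $G$, for some maximum matching $M$ of $G$.
   Context: All graphs are finite, undirected and simple. A matching is a set of pairwise nonadjacent edges; a maximum matching is a matching of maximum cardinality; a matching is perfect if every vertex is an endpoint of one of its edges. A walk in $G$ is a sequence of vertices $v_1v_2\cdots v_k$ with $v_iv_{i+1}\in E(G)$ for all $i$; its length is its number of edges counted with repetition. A path is a walk whose vertices are all different. A walk or path is $M$-alternating if for each pair of consecutive edges exactly one belongs to $M$; it is $mm$-alternating if moreover its first and last edges belong to $M$. Let $M$ be a maximum matching of $G$. An $M$-blossom is an odd cycle of length $2k+1$ in $G$ containing exactly $k$ edges of $M$; its base is the unique vertex of the cycle that is not matched by $M$ to another vertex of the cycle. An $M$-Tposy consists of two distinct (not necessarily disjoint) $M$-blossoms joined by an odd-length $mm$-alternating path (with respect to $M$) whose endpoints are the bases of the two blossoms and which is internally disjoint from the blossoms (no internal vertex of the path lies on either blossom). An $M$-Jposy consists of two (not necessarily distinct) $M$-blossoms joined by an odd-length $mm$-alternating walk (with respect to $M$) whose endpoints are the bases of the two blossoms. The vertices and edges of a configuration are those of its blossoms and of its path or walk. A graph $G$ is a Jposy-graph if there exists a perfect matching $M$ of $G$ such that $G$ contains an $M$-Jposy that uses all the vertices and all the edges of $G$. The maximum matching $M$ in the claim may depend on the vertex $v$. -}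

module Defs where

open import Level using (0ℓ)
open import Data.Nat using (ℕ; suc; _*_; _≤_)
open import Data.Fin using (Fin; _<?_)
open import Data.List using (List; []; _∷_; map; length; filter; head; last; allFin; cartesianProduct)
open import Data.List.Membership.Propositional using (_∈_)
open import Data.List.Relation.Unary.Linked using (Linked)
open import Data.List.Relation.Unary.Unique.Propositional using (Unique)
open import Data.Maybe.Relation.Unary.Any using (Any)
open import Data.Product using (Σ; ∃-syntax; _×_; _,_; proj₁; uncurry)
open import Data.Sum using (_⊎_)
open import Function.Bundles using (_⇔_)
open import Relation.Binary using (Rel; Symmetric; Irreflexive; Decidable)
open import Relation.Binary.Construct.Closure.ReflexiveTransitive using (Star; ε; _◅_)
open import Relation.Binary.PropositionalEquality using (_≡_; _≢_)
open import Relation.Nullary using (¬_)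
open import Relation.Nullary.Decidable using (_×-dec_)

record Graph : Set₁ where
  infix 4 _~_ _~?_
  field
    order   : ℕ
    _~_     : Rel (Fin order) 0ℓ
    _~?_    : Decidable _~_
    ~-sym   : Symmetric _~_
    ~-irrefl : Irreflexive _≡_ _~_

  Vertex : Set
  Vertex = Fin order

  Walk : Rel Vertex 0ℓ
  Walk = Star _~_

module _ (G : Graph) where
  open Graph G

  -- A set of edges, given as a symmetric relation; `functional` says that two
  -- edges sharing an endpoint coincide.
  record Matching : Set₁ where
    field
      Matched    : Rel Vertex 0ℓ
      matched?   : Decidable Matched
      symmetric  : Symmetric Matched
      isEdge     : ∀ {u v} → Matched u v → u ~ v
      functional : ∀ {u v w} → Matched u v → Matched u w → v ≡ w

    -- Each edge {u , v} is counted once, at its increasing orientation.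
    size : ℕ
    size = length (filter (λ (u , v) → (u <? v) ×-dec matched? u v)
                          (cartesianProduct (allFin order) (allFin order)))

  IsMaximum : Matching → Set₁
  IsMaximum M = ∀ (N : Matching) → Matching.size N ≤ Matching.size M

  IsPerfect : Matching → Set
  IsPerfect M = ∀ u → ∃[ v ] Matching.Matched M u v

-- Walks are the elements of `Star`: a walk from u to v is a chain of edges.
module _ {V : Set} {_~_ : Rel V 0ℓ} where

  vertices : ∀ {u v} → Star _~_ u v → List V
  vertices {u} ε       = u ∷ []
  vertices {u} (_ ◅ w) = u ∷ vertices w

  -- The edges of a walk in order, oriented in the direction of traversal.
  steps : ∀ {u v} → Star _~_ u v → List (V × V)
  steps ε                   = []
  steps (_◅_ {u} {v} _ w) = (u , v) ∷ steps w

  ∣_∣ : ∀ {u v} → Star _~_ u v → ℕ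
  ∣ w ∣ = length (steps w)

  VertexOf : ∀ {u v} → Star _~_ u v → V → Set
  VertexOf w x = x ∈ vertices w

  EdgeOf : ∀ {u v} → Star _~_ u v → Rel V 0ℓ
  EdgeOf w x y = (x , y) ∈ steps w ⊎ (y , x) ∈ steps w

  IsPath : ∀ {u v} → Star _~_ u v → Set
  IsPath w = Unique (vertices w)

  OddLength : ∀ {u v} → Star _~_ u v → Set
  OddLength w = ∃[ k ] ∣ w ∣ ≡ suc (2 * k)

  -- The sources of the steps of a closed walk are its vertices with the final
  -- return to the start omitted.
  IsCycle : ∀ {u} → Star _~_ u u → Set
  IsCycle w = 3 ≤ ∣ w ∣ × Unique (map proj₁ (steps w))

module _ {G : Graph} (M : Matching G) where
  open Graph G
  open Matching M

  InM : Vertex × Vertex → Set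
  InM = uncurry Matched

  ExactlyOneInM : Rel (Vertex × Vertex) 0ℓ
  ExactlyOneInM e f = (InM e × ¬ InM f) ⊎ (¬ InM e × InM f)

  Alternating : ∀ {u v} → Walk u v → Set
  Alternating w = Linked ExactlyOneInM (steps w)

  MMAlternating : ∀ {u v} → Walk u v → Set
  MMAlternating w =
    Alternating w × Any InM (head (steps w)) × Any InM (last (steps w))

  -- The traversal of the cycle may start at any of its vertices, not
  -- necessarily at the base.
  record Blossom : Set where
    field
      {start}  : Vertex
      cycle    : Walk start start
      isCycle  : IsCycle cycle
      k        : ℕ
      length≡  : ∣ cycle ∣ ≡ suc (2 * k)
      matched≡ : length (filter (λ (u , v) → matched? u v) (steps cycle)) ≡ k

  open Blossom using (cycle)

  -- The k matching edges cover all but one of the 2k + 1 vertices of the cycle,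
  -- so exactly one vertex satisfies this.
  IsBase : Blossom → Vertex → Set
  IsBase B b = VertexOf (cycle B) b × (∀ x → VertexOf (cycle B) x → ¬ Matched b x)

  -- Equality as subgraphs, irrespective of starting point and direction.
  SameBlossom : Rel Blossom 0ℓ
  SameBlossom B C = ∀ x y → EdgeOf (cycle B) x y ⇔ EdgeOf (cycle C) x y

  record Tposy : Set where
    field
      B₁ B₂         : Blossom
      distinct      : ¬ SameBlossom B₁ B₂
      {b₁ b₂}       : Vertex
      base₁         : IsBase B₁ b₁
      base₂         : IsBase B₂ b₂
      path          : Walk b₁ b₂
      isPath        : IsPath path
      odd           : OddLength path
      mmAlternating : MMAlternating path
      internallyDisjoint : ∀ x → VertexOf path x → x ≢ b₁ → x ≢ b₂ →
                           ¬ VertexOf (cycle B₁) x × ¬ VertexOf (cycle B₂) x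

    Contains : Vertex → Set
    Contains x = VertexOf (cycle B₁) x ⊎ VertexOf (cycle B₂) x ⊎ VertexOf path x

  record Jposy : Set where
    field
      B₁ B₂         : Blossom
      {b₁ b₂}       : Vertex
      base₁         : IsBase B₁ b₁
      base₂         : IsBase B₂ b₂
      walk          : Walk b₁ b₂
      odd           : OddLength walk
      mmAlternating : MMAlternating walk

    Contains : Vertex → Set
    Contains x = VertexOf (cycle B₁) x ⊎ VertexOf (cycle B₂) x ⊎ VertexOf walk x

    ContainsEdge : Rel Vertex 0ℓ
    ContainsEdge x y = EdgeOf (cycle B₁) x y ⊎ EdgeOf (cycle B₂) x y ⊎ EdgeOf walk x y

IsJposyGraph : Graph → Set₁
IsJposyGraph G =
  Σ (Matching G) λ M → IsPerfect G M ×
  Σ (Jposy M) λ J →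
    (∀ x → Jposy.Contains J x) ×
    (∀ x y → x ~ y → Jposy.ContainsEdge J x y)
  where open Graph G

module Submission where

-- For a perfect matching M, let x → y if x is adjacent to the mate of y. A Jposy
-- through all vertices makes this digraph strongly connected: its blossoms lead
-- from b₁ to the mate of b₁ and from b₂ to the mate of b₂, its walk from the mate
-- of b₁ to b₂, and reversing all arcs amounts to exchanging mates. Strong
-- connectivity does not depend on the choice of M.
--
-- From here on matchings are rebuilt at every step, and only parities matter. Call
-- posy a barbell (two disjoint odd cycles joined by an odd path) or a K₄ with
-- edges replaced by odd paths, such that the remaining vertices can be perfectly
-- matched. A directed path leaving a posy through an edge t ~ s either closes an
-- odd cycle, giving a flower attached at t, or returns to the posy, giving an odd
-- ear through s. In each case dropping pieces with an even number of vertices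
-- yields a posy through s, so a single posy spreads over the whole connected
-- graph. A first posy is found in the same way, starting from a lollipop (an odd
-- cycle with a pendant edge) and passing through thetas whose odd path gets
-- shorter. Finally a posy carries a perfect matching that makes it a Tposy, where
-- the blossoms of a K₄ overlap in one edge of it.

open import Data.Empty using (⊥; ⊥-elim)
open import Data.Fin using (toℕ) renaming (_<_ to _<ᶠ_; _<?_ to _<ᶠ?_)
open import Data.Fin.Properties using (_≟_; pigeonhole; <-cmp; <-asym)
open import Data.List
  using (List; []; _∷_; _++_; [_]; length; allFin; map; filter; head; last; cartesianProduct)
open import Data.List.Membership.Propositional using (_∈_; _∉_)
open import Data.List.Membership.Propositional.Properties
  using (∈-allFin; ∈-++⁻; ∈-++⁺ˡ; ∈-++⁺ʳ; ∈-∃++; ∈-filter⁺; ∈-filter⁻; ∈-cartesianProduct⁺)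
open import Data.List.Properties using (length-++; filter-accept; filter-reject)
  renaming (++-identityʳ to ++-[])
open import Data.List.Relation.Binary.Permutation.Propositional
  using (_↭_; refl; prep; swap; ↭-sym; ↭-trans; ↭-reflexive; ↭⇒↭ₛ)
open import Data.List.Relation.Binary.Permutation.Propositional.Properties
  using (++-commutativeMonoid; ++⁺ʳ; ++⁺ˡ; ++⁺; ++-comm; ++-assoc; ++-identityʳ; drop-∷; shift;
         ∈-resp-↭; ↭-length; filter-↭; map⁺)
import Data.List.Relation.Binary.Permutation.Setoid.Properties as Permutationₛ
open import Data.List.Relation.Unary.All as All using (All; []; _∷_)
open import Data.List.Relation.Unary.AllPairs as AllPairs using ([]; _∷_)
open import Data.List.Relation.Unary.Any using (here; there)
open import Data.List.Relation.Unary.Linked using (Linked; [-]; _∷_)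
open import Data.List.Relation.Unary.Unique.Propositional using (Unique)
open import Data.List.Relation.Unary.Unique.Propositional.Properties
  using (allFin⁺; cartesianProduct⁺; filter⁺; Unique[x∷xs]⇒x∉xs)
open import Data.Maybe.Relation.Unary.Any using (just) renaming (Any to AnyMaybe)
open import Data.Nat using (ℕ; zero; suc; _+_; _*_; _<_; _≤_; z≤n; s≤s; s≤s⁻¹)
open import Data.Nat.GeneralisedArithmetic using (fold)
open import Data.Nat.Induction using (Acc; acc; <-wellFounded)
open import Data.Nat.Properties
  using (≤-trans; ≤-reflexive; <-irrefl; n≤1+n; n<1+n; m≤n+m; m≤n⇒∃[o]m+o≡n; suc-injective;
         *-suc; *-cancelˡ-≤; module ≤-Reasoning)
open import Data.Product using (Σ; ∃-syntax; ∃₂; _×_; _,_; proj₁; proj₂)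
open import Data.Sum using (_⊎_; inj₁; inj₂)
open import Defs
open import Function using (_∘_)
open import Function.Bundles using (Equivalence)
open import Relation.Binary using (tri<; tri≈; tri>)
open import Relation.Binary.Construct.Closure.ReflexiveTransitive using (Star; ε; _◅_; _◅◅_)
open import Relation.Binary.PropositionalEquality
  using (_≡_; _≢_; refl; sym; trans; cong; subst; setoid)
open import Relation.Nullary using (¬_; Dec; yes; no)
open import Relation.Nullary.Decidable using (_×-dec_)

-- No single walk is required to be a path, and no two walks are required to be disjoint. A
-- configuration is recorded by one list of its vertices that, together with a perfectly matched
-- rest, is a permutation of all vertices; this one fact makes every piece simple and all pieces
-- disjoint. The case distinctions then come down to regrouping lists, which a solver for
-- commutative monoids can do. An even walk is listed without its first vertex and an odd walk
-- without its two ends, so the list of a walk always has even length and its consecutive entries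
-- can be paired. Hence a piece that is cut off can always join the matched rest. Rebuilding the
-- matching destroys alternation along everything found before. What survives is strong
-- connectivity, and it supplies the directed path for the next step.

module ↭-Solver {A : Set} where
  open import Algebra.Solver.CommutativeMonoid (++-commutativeMonoid {A = A}) public
    using (solve; _⊕_; _⊜_; id)
open ↭-Solver

++-cancelˡ : {A : Set} (xs : List A) {ys zs : List A} → xs ++ ys ↭ xs ++ zs → ys ↭ zs
++-cancelˡ []       p = p
++-cancelˡ (x ∷ xs) p = ++-cancelˡ xs (drop-∷ p)

-- Turns a permutation that holds modulo xs ↭ xs′ into one the solver can prove.
exchange : {A : Set} {xs xs′ ys zs : List A} → xs ↭ xs′ → xs′ ++ ys ↭ xs ++ zs → ys ↭ zs
exchange {xs = xs} {ys = ys} p q = ++-cancelˡ xs (↭-trans (++⁺ʳ ys p) q)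

module _ (G : Graph) where
  open Graph G
  open import Data.List.Membership.DecPropositional (_≟_ {order}) using (_∈?_)
  open Blossom using (cycle)

  private variable
    x y z w u v s t a b c d p q b′ : Vertex
    S T D L R A B C E F K P Q O ac ad bc bd cd S₁ S₂ O₁ O₂ T₁ T₂ : List Vertex

  -- Walks and parity

  -- The even walks from x, each with the list of its vertices other than x,
  -- last vertex first.
  data Arm (x : Vertex) : Vertex → List Vertex → Set where
    stop : Arm x x []
    snoc : ∀ {y S u v} → Arm x y S → y ~ u → u ~ v → Arm x v (v ∷ u ∷ S)

  -- Walks of even length, up to the order of their vertices other than the
  -- first, and walks of odd length, up to the order of their inner vertices.
  Even Odd : Vertex → Vertex → List Vertex → Set
  Even x y S = ∃[ T ] Arm x y T × T ↭ S
  Odd  x z S = ∃[ y ] ∃[ T ] Arm x y T × y ~ z × T ↭ S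

  data Adj : List Vertex → Set where
    []   : Adj []
    pair : u ~ v → Adj S → Adj (u ∷ v ∷ S)

  Paired : List Vertex → Set
  Paired S = ∃[ T ] Adj T × T ↭ S

  even-resp : S ↭ T → Even x y S → Even x y T
  even-resp p (_ , A , q) = _ , A , ↭-trans q p

  odd-resp : S ↭ T → Odd x y S → Odd x y T
  odd-resp p (_ , _ , A , e , q) = _ , _ , A , e , ↭-trans q p

  paired-resp : S ↭ T → Paired S → Paired T
  paired-resp p (_ , A , q) = _ , A , ↭-trans q p

  adj-++ : Adj S → Adj T → Adj (S ++ T)
  adj-++ []         B = B
  adj-++ (pair e A) B = pair e (adj-++ A B)

  paired-++ : Paired S → Paired T → Paired (S ++ T)
  paired-++ (_ , A , p) (_ , B , q) = _ , adj-++ A B , ++⁺ p q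

  paired-[] : Paired []
  paired-[] = [] , [] , refl

  paired-edge : u ~ v → Paired (u ∷ v ∷ [])
  paired-edge e = _ , pair e [] , refl

  arm-adj : Arm x y S → Adj S
  arm-adj stop         = []
  arm-adj (snoc A _ f) = pair (~-sym f) (arm-adj A)

  even-paired : Even x y S → Paired S
  even-paired (_ , A , p) = _ , arm-adj A , p

  odd-paired : Odd x y S → Paired S
  odd-paired (_ , _ , A , _ , p) = _ , arm-adj A , p

  even-nil : Even x x []
  even-nil = _ , stop , refl

  edge : x ~ y → Odd x y []
  edge e = _ , _ , stop , e , refl

  arm-++ : Arm x y S → Arm y z T → Arm x z (T ++ S)
  arm-++ A stop         = A
  arm-++ A (snoc B e f) = snoc (arm-++ A B) e f

  even-even : Even x y S → Even y z T → Even x z (S ++ T)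
  even-even {S = S} {T = T} (_ , A , p) (_ , B , q) =
    _ , arm-++ A B , ↭-trans (++⁺ q p) (++-comm T S)

  even-odd : Even x y S → Odd y z T → Odd x z (S ++ T)
  even-odd E (_ , _ , B , e , q) with even-even E (_ , B , q)
  ... | _ , A , p = _ , _ , A , e , p

  odd-edge : Odd x y S → y ~ z → Even x z (z ∷ y ∷ S)
  odd-edge (_ , _ , A , e , p) f = _ , snoc A e f , prep _ (prep _ p)

  odd-odd : Odd x y S → Odd y z T → Even x z (z ∷ y ∷ S ++ T)
  odd-odd {x} {y} {S} P (w , T′ , B , e , q) =
    even-resp (prep _ (prep _ (++⁺ˡ S q))) (go B e)
    where
    go : ∀ {w z T′} → Arm y w T′ → w ~ z → Even x z (z ∷ y ∷ S ++ T′)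
    go stop f = even-resp (prep _ (prep _ (↭-sym (++-identityʳ S)))) (odd-edge P f)
    go {z = z} (snoc {S = R} {u = u} {v = v} B e g) f with go B e
    ... | _ , A , p = _ , snoc A g f , ↭-trans (prep z (prep v p))
      (solve 6 (λ z v u y S R → z ⊕ v ⊕ u ⊕ y ⊕ S ⊕ R ⊜ z ⊕ y ⊕ S ⊕ v ⊕ u ⊕ R)
        refl [ z ] [ v ] [ u ] [ y ] S R)

  odd-sym : Odd x z S → Odd z x S
  odd-sym (_ , _ , A , e , p) = odd-resp p (go A e)
    where
    go : ∀ {y z S} → Arm x y S → y ~ z → Odd z x S
    go stop e = edge (~-sym e)
    go (snoc {u = u} {v = v} A e f) g =
      odd-resp (swap _ _ refl) (even-odd (odd-edge (edge (~-sym g)) (~-sym f)) (go A e))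

  -- The list of an even walk contains its end but not its start, so reversal exchanges the two;
  -- only the list completed by the starting vertex stays the same.
  even-sym : Even x y S → ∃[ T ] Even y x T × y ∷ T ↭ x ∷ S
  even-sym (_ , stop , p) = _ , (_ , stop , p) , refl
  even-sym {x} {y} {S} (_ , snoc {S = R} {u = u} A e f , p) =
    _ , odd-odd (edge (~-sym f)) (odd-sym (_ , _ , A , e , refl)) ,
    ↭-trans (swap y x refl) (prep x p)

  odd-even : Odd x y S → Even z y T → Odd x z (S ++ T)
  odd-even {S = S} {T = T} P E = odd-resp (++-comm T S) (odd-sym (even-odd E (odd-sym P)))

  odd-odd-odd : Odd x y S → Odd y z T → Odd z w D → Odd x w (S ++ y ∷ T ++ z ∷ D)
  odd-odd-odd {y = y} {S = S} {z = z} {T = T} {D = D} P Q R =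
    odd-resp (solve 5 (λ y z S T D → (z ⊕ y ⊕ S ⊕ T) ⊕ D ⊜ S ⊕ y ⊕ T ⊕ z ⊕ D)
               refl [ y ] [ z ] S T D)
      (even-odd (odd-odd P Q) R)

  even-tail : Even x y S → x ≢ y → ∃[ T ] S ↭ y ∷ T
  even-tail (_ , stop , p)       x≢y = ⊥-elim (x≢y refl)
  even-tail (_ , snoc A e f , p) x≢y = _ , ↭-sym p

  -- The cases are the parities of the distance from `x` to `z`. If it is odd, neither `z` nor `y`
  -- belongs to the lists of the two odd walks, so both are listed apart.
  even-split : Even x y S → z ∈ S →
    (∃₂ λ S₁ S₂ → Even x z S₁ × Even z y S₂ × S ↭ S₁ ++ S₂) ⊎
    (∃₂ λ S₁ S₂ → Odd x z S₁ × Odd z y S₂ × S ↭ z ∷ y ∷ S₁ ++ S₂)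
  even-split {x} {z = z} (_ , A , p) i with go A (∈-resp-↭ (↭-sym p) i)
    where
    go : ∀ {y S} → Arm x y S → z ∈ S →
      (∃₂ λ S₁ S₂ → Even x z S₁ × Even z y S₂ × S ↭ S₁ ++ S₂) ⊎
      (∃₂ λ S₁ S₂ → Odd x z S₁ × Odd z y S₂ × S ↭ z ∷ y ∷ S₁ ++ S₂)
    go (snoc A e f) (here refl) =
      inj₁ (_ , [] , (_ , snoc A e f , refl) , even-nil , ↭-sym (++-identityʳ _))
    go (snoc A e f) (there (here refl)) =
      inj₂ (_ , [] , (_ , _ , A , e , refl) , edge f ,
            swap _ _ (↭-sym (++-identityʳ _)))
    go (snoc {S = R} {u = u} {v = v} A e f) (there (there i)) with go A i
    ... | inj₁ (S₁ , S₂ , P , (_ , Q , q) , r) =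
      inj₁ (S₁ , v ∷ u ∷ S₂ , P , (_ , snoc Q e f , prep _ (prep _ q)) ,
        exchange r (solve 5 (λ u v R S₁ S₂ → (S₁ ⊕ S₂) ⊕ v ⊕ u ⊕ R ⊜ R ⊕ S₁ ⊕ v ⊕ u ⊕ S₂)
          refl [ u ] [ v ] R S₁ S₂))
    ... | inj₂ (S₁ , S₂ , P , Q , r) =
      inj₂ (S₁ , _ , P , odd-even Q (_ , snoc stop (~-sym f) (~-sym e) , refl) ,
        exchange r (solve 7 (λ z y u v R S₁ S₂ →
            (z ⊕ y ⊕ S₁ ⊕ S₂) ⊕ v ⊕ u ⊕ R ⊜ R ⊕ z ⊕ v ⊕ S₁ ⊕ S₂ ⊕ y ⊕ u)
          refl [ z ] [ _ ] [ u ] [ v ] R S₁ S₂))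
  ... | inj₁ (S₁ , S₂ , P , Q , r) = inj₁ (S₁ , S₂ , P , Q , ↭-trans (↭-sym p) r)
  ... | inj₂ (S₁ , S₂ , P , Q , r) = inj₂ (S₁ , S₂ , P , Q , ↭-trans (↭-sym p) r)

  -- The distances from `z` to the two ends have different parities. The even walk is oriented
  -- towards `z`, so its list contains `z`.
  odd-split : Odd x w S → z ∈ S →
    (∃₂ λ S₁ S₂ → Even x z S₁ × Odd z w S₂ × S ↭ S₁ ++ S₂) ⊎
    (∃₂ λ S₁ S₂ → Odd x z S₁ × Even w z S₂ × S ↭ S₁ ++ S₂)
  odd-split {z = z} (y , _ , A , e , p) i with even-split (_ , A , p) i
  ... | inj₁ (S₁ , S₂ , P , Q , r) =
    inj₁ (S₁ , _ , P , even-odd Q (edge e) , ↭-trans r (++⁺ˡ S₁ (↭-sym (++-identityʳ S₂))))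
  ... | inj₂ (S₁ , S₂ , P , Q , r) =
    inj₂ (S₁ , _ , P , odd-odd (edge (~-sym e)) (odd-sym Q) ,
      ↭-trans r (solve 4 (λ z y S₁ S₂ → z ⊕ y ⊕ S₁ ⊕ S₂ ⊜ S₁ ⊕ z ⊕ y ⊕ S₂)
        refl [ z ] [ y ] S₁ S₂))

  -- Perfect matchings

  unique-resp : S ↭ T → Unique S → Unique T
  unique-resp p = Permutationₛ.Unique-resp-↭ (setoid Vertex) (↭⇒↭ₛ p)

  record PerfectMatching : Set where
    field
      mate       : Vertex → Vertex
      mate-edge  : ∀ v → v ~ mate v
      mate-mate  : ∀ v → mate (mate v) ≡ v

    mate-injective : mate u ≡ mate v → u ≡ v
    mate-injective {u} {v} e = trans (sym (mate-mate u)) (trans (cong mate e) (mate-mate v))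

    data Along : List Vertex → Set where
      []   : Along []
      pair : mate u ≡ v → Along S → Along (u ∷ v ∷ S)

    Saturated : List Vertex → Set
    Saturated S = ∃[ T ] Along T × T ↭ S

    along-++ : Along S → Along T → Along (S ++ T)
    along-++ []         B = B
    along-++ (pair e A) B = pair e (along-++ A B)

    -- The pairing of `S` shows that the cut is at an even position and splits no matched pair.
    along-++⁻ : Adj S → Along (S ++ T) → Along S × Along T
    along-++⁻ []         C = [] , C
    along-++⁻ (pair _ A) (pair e C) with along-++⁻ A C
    ... | B , B′ = pair e B , B′

    saturated-resp : S ↭ T → Saturated S → Saturated T
    saturated-resp p (_ , A , q) = _ , A , ↭-trans q p

    saturated-++ : Saturated S → Saturated T → Saturated (S ++ T)
    saturated-++ (_ , A , p) (_ , B , q) = _ , along-++ A B , ++⁺ p q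

    along-mate : Along S → v ∈ S → mate v ∈ S
    along-mate (pair refl A) (here refl)         = there (here refl)
    along-mate (pair refl A) (there (here refl)) = here (mate-mate _)
    along-mate (pair _ A)    (there (there i))   = there (there (along-mate A i))

    saturated-mate : Saturated S → v ∈ S → mate v ∈ S
    saturated-mate (_ , A , p) i = ∈-resp-↭ p (along-mate A (∈-resp-↭ (↭-sym p) i))

    saturated-mate⁻ : Saturated S → mate v ∈ S → v ∈ S
    saturated-mate⁻ A i = subst (_∈ _) (mate-mate _) (saturated-mate A i)

    along-paired : Along S → Adj S
    along-paired []            = []
    along-paired (pair refl A) = pair (mate-edge _) (along-paired A)

    saturated-paired : Saturated S → Paired S
    saturated-paired (_ , A , p) = _ , along-paired A , p

    extract : Saturated S → v ∈ S → ∃[ T ] Saturated T × S ↭ v ∷ mate v ∷ T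
    extract (_ , A , p) i with go A (∈-resp-↭ (↭-sym p) i)
      where
      go : ∀ {S v} → Along S → v ∈ S → ∃[ T ] Along T × S ↭ v ∷ mate v ∷ T
      go (pair refl A) (here refl)         = _ , A , refl
      go (pair {u} {S = S} refl A) (there (here refl)) =
        _ , A , subst (λ w → u ∷ mate u ∷ S ↭ mate u ∷ w ∷ S) (sym (mate-mate u)) (swap _ _ refl)
      go {v = v} (pair {u = u} {v = w} e A) (there (there i)) with go A i
      ... | T , B , q = _ , pair e B , ↭-trans (prep u (prep w q))
        (solve 5 (λ u w v v′ T → u ⊕ w ⊕ v ⊕ v′ ⊕ T ⊜ v ⊕ v′ ⊕ u ⊕ w ⊕ T)
          refl [ u ] [ w ] [ v ] [ mate v ] T)
    ... | T , B , q = T , (_ , B , refl) , ↭-trans (↭-sym p) q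

  open PerfectMatching

  -- The value at vertices outside the list is a dummy: `matching` applies this to a list of all
  -- vertices.
  mateIn : List Vertex → Vertex → Vertex
  mateIn []          v = v
  mateIn (u ∷ [])    v = v
  mateIn (u ∷ w ∷ S) v with u ≟ v | w ≟ v
  ... | yes _ | _     = w
  ... | no _  | yes _ = u
  ... | no _  | no _  = mateIn S v

  mateIn-first : ∀ u w S → mateIn (u ∷ w ∷ S) u ≡ w
  mateIn-first u w S with u ≟ u
  ... | yes _ = refl
  ... | no u≢u = ⊥-elim (u≢u refl)

  mateIn-second : ∀ u w S → u ≢ w → mateIn (u ∷ w ∷ S) w ≡ u
  mateIn-second u w S u≢w with u ≟ w | w ≟ w
  ... | yes u≡w | _      = ⊥-elim (u≢w u≡w)
  ... | no _    | yes _  = refl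
  ... | no _    | no w≢w = ⊥-elim (w≢w refl)

  mateIn-skip : ∀ u w S → u ≢ v → w ≢ v → mateIn (u ∷ w ∷ S) v ≡ mateIn S v
  mateIn-skip {v} u w S u≢v w≢v with u ≟ v | w ≟ v
  ... | yes u≡v | _      = ⊥-elim (u≢v u≡v)
  ... | no _    | yes w≡v = ⊥-elim (w≢v w≡v)
  ... | no _    | no _   = refl

  mateIn-pairs : Adj S → Unique S → v ∈ S →
    v ~ mateIn S v × mateIn S v ∈ S × mateIn S (mateIn S v) ≡ v
  mateIn-pairs (pair {u} {w} {S} e A) ((u≢w ∷ _) ∷ _) (here refl)
    rewrite mateIn-first u w S = e , there (here refl) , mateIn-second u w S u≢w
  mateIn-pairs (pair {u} {w} {S} e A) ((u≢w ∷ _) ∷ _) (there (here refl))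
    rewrite mateIn-second u w S u≢w = ~-sym e , here refl , mateIn-first u w S
  mateIn-pairs {v = v} (pair {u} {w} {S} e A) ((u≢w ∷ u∉) ∷ w∉ ∷ U) (there (there i))
    with mateIn-pairs A U i
  ... | f , j , q
    rewrite mateIn-skip u w S (All.lookup u∉ i) (All.lookup w∉ i) =
    f , there (there j) , trans (mateIn-skip u w S (All.lookup u∉ j) (All.lookup w∉ j)) q

  module _ {L : List Vertex} (A : Adj L) (L↭ : L ↭ allFin order) where

    private
      L-unique : Unique L
      L-unique = unique-resp (↭-sym L↭) (allFin⁺ order)

      ∈L : ∀ v → v ∈ L
      ∈L v = ∈-resp-↭ (↭-sym L↭) (∈-allFin v)

    matching : PerfectMatching
    matching = record
      { mate      = mateIn L
      ; mate-edge = λ v → proj₁ (mateIn-pairs A L-unique (∈L v))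
      ; mate-mate = λ v → proj₂ (proj₂ (mateIn-pairs A L-unique (∈L v)))
      }

    matching-along : Along matching L
    matching-along = go A L-unique (λ _ → refl)
      where
      go : ∀ {S} → Adj S → Unique S → (∀ {v} → v ∈ S → mateIn L v ≡ mateIn S v) →
           Along matching S
      go []                     _ _ = []
      go (pair {u} {w} {S} _ B) ((u≢w ∷ u∉) ∷ w∉ ∷ U) agree =
        pair (trans (agree (here refl)) (mateIn-first u w S))
             (go B U λ i → trans (agree (there (there i)))
                             (mateIn-skip u w S (All.lookup u∉ i) (All.lookup w∉ i)))

  -- Directed paths along a matching

  -- An unmatched edge followed by a matched one, the latter ending in y.
  Arc : PerfectMatching → Vertex → Vertex → Set
  Arc M x y = x ~ mate M y

  StronglyConnected : PerfectMatching → Set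
  StronglyConnected M = ∀ x y → Star (Arc M) x y

  -- Two of the first `order + 1` iterates coincide, and injectivity cancels the shorter iteration.
  orbit-returns : (f : Vertex → Vertex) → (∀ {u v} → f u ≡ f v → u ≡ v) →
    ∀ v → ∃[ d ] v ≡ fold v f (suc d)
  orbit-returns f f-injective v with pigeonhole (n<1+n order) (λ i → fold v f (toℕ i))
  ... | i , j , i<j , eq with m≤n⇒∃[o]m+o≡n i<j
  ... | d , refl′ = d , cancel (toℕ i) (trans eq (cong (fold v f) (sym refl′)))
    where
    cancel : ∀ i → fold v f i ≡ fold v f (suc i + d) → v ≡ fold v f (suc d)
    cancel zero    e = e
    cancel (suc i) e = cancel i (f-injective e)

  -- Every vertex z has an arc to mate M (mate N z); this is a permutation, so
  -- iterating it leads back to z.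
  strongly-connected-any : ∀ N → StronglyConnected N → ∀ M → StronglyConnected M
  strongly-connected-any N conn M x y = go (conn x y)
    where
    φ : Vertex → Vertex
    φ z = mate M (mate N z)

    forth : ∀ z → Arc M z (φ z)
    forth z = subst (z ~_) (sym (mate-mate M (mate N z))) (mate-edge N z)

    orbit : ∀ z d → Star (Arc M) (φ z) (fold z φ (suc d))
    orbit z zero    = ε
    orbit z (suc d) = orbit z d ◅◅ forth _ ◅ ε

    back : ∀ z → Star (Arc M) (φ z) z
    back z with orbit-returns φ (λ e → mate-injective N (mate-injective M e)) z
    ... | d , e = subst (Star (Arc M) (φ z)) (sym e) (orbit z d)

    go : ∀ {x y} → Star (Arc N) x y → Star (Arc M) x y
    go ε = ε
    -- The edge from `x` to `mate N y`, read as an arc for `M`, ends in `φ y` instead of `y`; `back`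
    -- makes up for the difference.
    go (_◅_ {i = x} {j = y} a p) =
      subst (x ~_) (sym (mate-mate M (mate N y))) a ◅ (back y ◅◅ go p)

  Part : List Vertex → Set
  Part L = ∃[ R ] Paired R × L ++ R ↭ allFin order

  part-resp : L ↭ T → Part L → Part T
  part-resp p (R , A , q) = R , A , ↭-trans (++⁺ʳ R (↭-sym p)) q

  part-drop : ∀ L → Paired D → Part (L ++ D) → Part L
  part-drop {D} L B (R , A , p) = _ , paired-++ B A ,
    ↭-trans (solve 3 (λ L D R → L ⊕ D ⊕ R ⊜ (L ⊕ D) ⊕ R) refl L D R) p

  unique-prefix : ∀ S → Unique (S ++ T) → Unique S
  unique-prefix []      _       = []
  unique-prefix (x ∷ S) (p ∷ U) = go S p ∷ unique-prefix S U
    where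
    go : ∀ {x} S → All (x ≢_) (S ++ T) → All (x ≢_) S
    go []      _        = []
    go (_ ∷ S) (p ∷ ps) = p ∷ go S ps

  part-unique : Part L → Unique L
  part-unique {L} (_ , _ , p) = unique-prefix L (unique-resp (↭-sym p) (allFin⁺ order))

  -- Leaving a part of the graph

  -- An odd cycle outside L, joined to x by an even walk whose vertices other
  -- than x are outside L.
  record Flower (x : Vertex) (L : List Vertex) : Set where
    constructor flower
    field
      {base}      : Vertex
      {stem₀ cycle₀} : List Vertex
      stem        : Even x base stem₀
      cycle       : Odd base base cycle₀
      part        : Part (L ++ stem₀ ++ cycle₀)

  -- The ends may coincide, in which case the ear closes an odd cycle at `x`.
  record Ear (x z : Vertex) (L : List Vertex) : Set where
    constructor ear
    field
      {inner} : List Vertex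
      walk    : Odd x z inner
      part    : Part (L ++ inner)

  module _ (M : PerfectMatching) {L R : List Vertex}
           (L-sat : Saturated M L) (R-sat : Saturated M R) (L++R : L ++ R ↭ allFin order) where

    -- A directed path stopped at its first vertex `w` in `L`. In the graph it already reaches `L`
    -- at `mate M w`, since `L` is saturated.
    data Outside : Vertex → Vertex → Set where
      enter : u ∉ L → Arc M u w → w ∈ L → Outside u w
      stay  : u ∉ L → Arc M u v → Outside v w → Outside u w

    ∉L⇒∈R : v ∉ L → v ∈ R
    ∉L⇒∈R {v} v∉L with ∈-++⁻ L (∈-resp-↭ (↭-sym L++R) (∈-allFin v))
    ... | inj₁ v∈L = ⊥-elim (v∉L v∈L)
    ... | inj₂ v∈R = v∈R

    mate-∉L : v ∉ L → mate M v ∉ L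
    mate-∉L v∉L i = v∉L (saturated-mate⁻ M L-sat i)

    outside-∉ : Outside u w → u ∉ L
    outside-∉ (enter u∉L _ _) = u∉L
    outside-∉ (stay u∉L _ _)  = u∉L

    module _ {x s : Vertex} (x~s : x ~ s) where

      -- A directed path as a walk in the graph, each arc giving an edge to `u` and then the matched
      -- edge at `u`. That no vertex repeats is ensured by `extend`, where trail and unvisited
      -- vertices together form `R`.
      data Trail : Vertex → List Vertex → Set where
        start : Trail (mate M s) (mate M s ∷ s ∷ [])
        snoc  : ∀ {y S u} → Trail y S → y ~ u → Trail (mate M u) (mate M u ∷ u ∷ S)

      trail-arm : Trail y S → Arm x y S
      trail-arm start      = snoc stop x~s (mate-edge M s)
      trail-arm (snoc P e) = snoc (trail-arm P) e (mate-edge M _)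

      trail-along : Trail y S → Along M S
      trail-along start      = pair (mate-mate M s) []
      trail-along (snoc P e) = pair (mate-mate M _) (trail-along P)

      trail-even : Trail y S → Even x y S
      trail-even P = _ , trail-arm P , refl

      s∈trail : Trail y S → s ∈ S
      s∈trail start      = there (here refl)
      s∈trail (snoc P _) = there (there (s∈trail P))

      -- A trail about to run into its own vertex v either closes an odd cycle at
      -- v or may be cut short before v.
      collide : Trail y S → v ∈ S →
        (∃₂ λ S₁ S₂ → Trail (mate M v) S₁ × Saturated M S₂ × S ↭ S₁ ++ S₂) ⊎
        (∃₂ λ S₁ S₂ → Even x v S₁ × s ∈ S₁ ++ S₂ × Even v y S₂ × S ↭ S₁ ++ S₂)
      collide start (here refl) =
        inj₂ (_ , [] , trail-even start , there (here refl) , even-nil , refl)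
      collide start (there (here refl)) = inj₁ (_ , [] , start , ([] , [] , refl) , refl)
      collide (snoc P e) (here refl) = inj₂ (_ , [] , trail-even (snoc P e) ,
        ∈-++⁺ˡ (s∈trail (snoc P e)) , even-nil , ↭-sym (++-identityʳ _))
      collide (snoc P e) (there (here refl)) =
        inj₁ (_ , [] , snoc P e , ([] , [] , refl) , ↭-sym (++-identityʳ _))
      collide (snoc {S = S} {u = u} P e) (there (there i)) with collide P i
      ... | inj₁ (S₁ , S₂ , Q , (_ , A , q) , p) =
        inj₁ (S₁ , _ , Q , (_ , pair (mate-mate M u) A , prep _ (prep _ q)) ,
          exchange p (solve 5 (λ u u′ S S₁ S₂ → (S₁ ⊕ S₂) ⊕ u′ ⊕ u ⊕ S ⊜ S ⊕ S₁ ⊕ u′ ⊕ u ⊕ S₂)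
            refl [ u ] [ mate M u ] S S₁ S₂))
      ... | inj₂ (S₁ , S₂ , Q , j , (_ , A , q) , p) =
        inj₂ (S₁ , _ , Q , ∈-resp-↭ r (there (there (s∈trail P))) ,
          (_ , snoc A e (mate-edge M u) , prep _ (prep _ q)) , r)
        where
        r = exchange p (solve 5 (λ u u′ S S₁ S₂ → (S₁ ⊕ S₂) ⊕ u′ ⊕ u ⊕ S ⊜ S ⊕ S₁ ⊕ u′ ⊕ u ⊕ S₂)
              refl [ u ] [ mate M u ] S S₁ S₂)

      Result : Vertex → Set
      Result z =
        Σ (Flower x L) (λ f → s ∈ Flower.stem₀ f ++ Flower.cycle₀ f) ⊎
        Σ (Ear x z L) (λ e → s ∈ Ear.inner e)

      private
        part-of : Saturated M T → R ↭ S ++ T → Part (L ++ S)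
        part-of {T} {S} A p = T , saturated-paired M A ,
          ↭-trans (exchange (↭-sym p) (solve 4 (λ L R S T → R ⊕ (L ⊕ S) ⊕ T ⊜ (S ⊕ T) ⊕ L ⊕ R)
                               refl L R S T))
                  L++R

        -- Loop erasure, with `T` the vertices of `R` off the trail. A new matched pair moves from
        -- `T` to the trail; running into the trail either yields a flower or cuts the trail short,
        -- and then the loop returns to `T`. The recursion is on the path still to be followed,
        -- since the trail may shrink.
        extend : Trail y S → Saturated M T → R ↭ S ++ T → Outside y w → Result (mate M w)
        extend P A p (enter _ a _) =
          inj₂ (ear (_ , _ , trail-arm P , a , refl) (part-of A p) , s∈trail P)
        extend {S = S} {T = T} P A p (stay {v = v} _ a Q)
          with ∈-++⁻ S (∈-resp-↭ p (∉L⇒∈R (mate-∉L (outside-∉ Q))))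
        ... | inj₂ i with extract M A i
        ...   | T′ , A′ , q = extend
          (subst (λ w → Trail w (mate M (mate M v) ∷ mate M v ∷ S)) (mate-mate M v) (snoc P a)) A′
          (↭-trans p (exchange q (solve 5 (λ v v′ S T T′ →
              (v ⊕ v′ ⊕ T′) ⊕ S ⊕ T ⊜ T ⊕ (v′ ⊕ v ⊕ S) ⊕ T′)
            refl [ mate M v ] [ mate M (mate M v) ] S T T′))) Q
        extend {S = S} {T = T} P A p (stay {v = v} _ a Q) | inj₁ i with collide P i
        ... | inj₁ (S₁ , S₂ , P′ , A′ , q) = extend
          (subst (λ w → Trail w S₁) (mate-mate M v) P′) (saturated-++ M A′ A)
          (↭-trans p (↭-trans (++⁺ʳ T q) (++-assoc S₁ S₂ T))) Q
        ... | inj₂ (S₁ , S₂ , P′ , j , P″ , q) =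
          inj₁ (flower P′ (even-odd P″ (edge a))
                 (part-of A (↭-trans p (++⁺ʳ T
                   (↭-trans q (++⁺ˡ S₁ (↭-sym (++-identityʳ S₂))))))) ,
               subst (λ T → s ∈ S₁ ++ T) (sym (++-[] S₂)) j)

      exit : Outside (mate M s) w → Result (mate M w)
      exit Q with extract M R-sat (∉L⇒∈R (outside-∉ Q))
      ... | T , A , p = extend start A (↭-trans p
        (subst (λ v → mate M s ∷ v ∷ T ↭ mate M s ∷ s ∷ T) (sym (mate-mate M s)) refl)) Q

    leave : Star (Arc M) u w → u ∉ L → w ∈ L → ∃[ v ] Outside u v
    leave ε u∉L u∈L = ⊥-elim (u∉L u∈L)
    leave (_◅_ {j = v} a p) u∉L w∈L with v ∈? L
    ... | yes v∈L = _ , enter u∉L a v∈L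
    ... | no  v∉L with leave p v∉L w∈L
    ...   | _ , Q = _ , stay u∉L a Q

    Exit : Vertex → Vertex → Set
    Exit x z = Flower x L ⊎ Ear x z L

    -- Think of `W` as a part of `L`. The path starts in `W` and ends in `L` outside `W`, so some
    -- stretch of it that avoids `L` in between leads from one to the other. A return to `W`
    -- restarts the search.
    cross : ∀ W → Star (Arc M) u w → u ∈ W → w ∈ L → w ∉ W →
      ∃₂ λ x v → x ∈ W × v ∈ L × v ∉ W × Exit x (mate M v)
    cross {w = w} W p u∈W w∈L w∉W = inside p u∈W
      where
      Crossing : Set
      Crossing = ∃₂ λ x v → x ∈ W × v ∈ L × v ∉ W × Exit x (mate M v)

      inside : ∀ {u} → Star (Arc M) u w → u ∈ W → Crossing
      outside : ∀ {u} → Star (Arc M) u w → u ∉ L → (∃[ v ] v ∈ L × v ∉ W × Outside u v) ⊎ Crossing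

      inside ε u∈W = ⊥-elim (w∉W u∈W)
      inside (_◅_ {j = v} a p) u∈W with v ∈? W | v ∈? L
      ... | yes v∈W | _       = inside p v∈W
      ... | no v∉W  | yes v∈L = _ , _ , u∈W , v∈L , v∉W ,
        inj₂ (ear (edge a)
          (part-resp (↭-sym (++-identityʳ L)) (R , saturated-paired M R-sat , L++R)))
      ... | no v∉W  | no v∉L  with outside p v∉L
      ...   | inj₂ c = c
      ...   | inj₁ (v′ , v′∈L , v′∉W , Q)
        with exit a (subst (λ v → Outside v v′) (sym (mate-mate M v)) Q)
      ...     | inj₁ (f , _) = _ , _ , u∈W , v′∈L , v′∉W , inj₁ f
      ...     | inj₂ (e , _) = _ , _ , u∈W , v′∈L , v′∉W , inj₂ e

      outside ε u∉L = ⊥-elim (u∉L w∈L)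
      outside (_◅_ {j = v} a p) u∉L with v ∈? L | v ∈? W
      ... | yes v∈L | yes v∈W = inj₂ (inside p v∈W)
      ... | yes v∈L | no v∉W  = inj₁ (v , v∈L , v∉W , enter u∉L a v∈L)
      ... | no v∉L  | _ with outside p v∉L
      ...   | inj₁ (v′ , v′∈L , v′∉W , Q) = inj₁ (v′ , v′∈L , v′∉W , stay u∉L a Q)
      ...   | inj₂ c = inj₂ c

  -- Barbells and subdivisions of K₄

  -- What a posy has besides one distinguished path from `a` to `b`: two odd cycles, or the other
  -- five edges of the K₄. Singling out a path lets both kinds share most arguments.
  data Frame (a b : Vertex) : List Vertex → Set where
    barbell : Odd a a C → Odd b b D → Frame a b (C ++ D)
    k4      : Odd a c ac → Odd a d ad → Odd b c bc → Odd b d bd → Odd c d cd →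
              Frame a b (c ∷ d ∷ ac ++ ad ++ bc ++ bd ++ cd)

  -- L lists the vertices of two disjoint odd cycles joined by an odd path, or of
  -- a K₄ each of whose edges is replaced by an odd path.
  Posy : List Vertex → Set
  Posy L = ∃₂ λ a b → ∃₂ λ P F → Odd a b P × Frame a b F × a ∷ b ∷ P ++ F ↭ L

  posy-resp : L ↭ K → Posy L → Posy K
  posy-resp p (_ , _ , _ , _ , P , F , q) = _ , _ , _ , _ , P , F , ↭-trans q p

  posy : Odd a b P → Frame a b F → Posy (a ∷ b ∷ P ++ F)
  posy P F = _ , _ , _ , _ , P , F , refl

  -- From the vertices of L and E, a posy through all of E can be formed that
  -- leaves a perfectly matched rest.
  Extension : List Vertex → List Vertex → Set
  Extension L E = ∃₂ λ K D → Posy (E ++ K) × Paired D × L ↭ K ++ D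

  extension-resp : L ↭ K → Extension L E → Extension K E
  extension-resp p (_ , _ , Q , D , q) = _ , _ , Q , D , ↭-trans (↭-sym p) q

  extension : Posy T → T ↭ E ++ K → Paired D → L ↭ K ++ D → Extension L E
  extension Q p D q = _ , _ , posy-resp p Q , D , q

  frame-swap : Frame a b F → ∃[ F′ ] Frame b a F′ × F ↭ F′
  frame-swap (barbell {C = C} {D = D} P Q) = _ , barbell Q P , ++-comm C D
  frame-swap (k4 {c} {ac} {d} {ad} {bc} {bd} {cd} P Q R S T) = _ , k4 R S P Q T ,
    solve 7 (λ c d ac ad bc bd cd → c ⊕ d ⊕ ac ⊕ ad ⊕ bc ⊕ bd ⊕ cd ⊜ c ⊕ d ⊕ bc ⊕ bd ⊕ ac ⊕ ad ⊕ cd)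
      refl [ c ] [ d ] ac ad bc bd cd

  -- In a K₄ the cycle is the triangle on `b`, `c`, `d`; the insides of the two paths from `a` are
  -- left over.
  frame-cycle : Frame a b F → ∃₂ λ C D → Odd b b C × Paired D × F ↭ C ++ D
  frame-cycle (barbell {C = C} {D = D} P Q) = _ , _ , Q , odd-paired P , ++-comm C D
  frame-cycle (k4 {c} {ac} {d} {ad} {bc} {bd} {cd} P Q R S T) =
    _ , _ , odd-odd-odd R T (odd-sym S) , paired-++ (odd-paired P) (odd-paired Q) ,
    solve 7 (λ c d ac ad bc bd cd → c ⊕ d ⊕ ac ⊕ ad ⊕ bc ⊕ bd ⊕ cd ⊜
                                    (bc ⊕ c ⊕ cd ⊕ d ⊕ bd) ⊕ ac ⊕ ad)
      refl [ c ] [ d ] ac ad bc bd cd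

  -- Reversing an odd cycle changes the parity of the distance from `a` to `z`, so this distance may
  -- be taken even.
  cycle-split : Odd a a C → z ∈ C →
    ∃₂ λ S₁ S₂ → Even a z S₁ × Odd z a S₂ × C ↭ S₁ ++ S₂
  cycle-split P i with odd-split P i
  ... | inj₁ r = r
  ... | inj₂ (S₁ , S₂ , Q , R , p) = S₂ , S₁ , R , odd-sym Q , ↭-trans p (++-comm S₁ S₂)

  odd-split-end : Odd x w S → z ∈ w ∷ S →
    (∃₂ λ S₁ S₂ → Even x z S₁ × Odd z w S₂ × S ↭ S₁ ++ S₂) ⊎
    (∃₂ λ S₁ S₂ → Odd x z S₁ × Even w z S₂ × S ↭ S₁ ++ S₂)
  odd-split-end P (here refl) = inj₂ (_ , [] , P , even-nil , ↭-sym (++-identityʳ _))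
  odd-split-end P (there i)   = odd-split P i

  -- The even stem prolongs the path from `b` to `x` to an odd path ending in `u`, so the two cycles
  -- form a barbell.
  hang : Even x u S → Odd u u C → Odd x b P → Odd b b D → Posy (x ∷ S ++ b ∷ P ++ C ++ D)
  hang {x} {u} {S} {C} {b} {P} {D} st cy pa dy with even-sym st
  ... | S′ , st′ , p = posy-resp
    (exchange p (solve 8 (λ x u b S S′ C P D →
        (x ⊕ S) ⊕ u ⊕ b ⊕ (S′ ⊕ P) ⊕ C ⊕ D ⊜ (u ⊕ S′) ⊕ x ⊕ S ⊕ b ⊕ P ⊕ C ⊕ D)
      refl [ x ] [ u ] [ b ] S S′ C P D))
    (posy (even-odd st′ pa) (barbell cy dy))

  -- Flowers and ears at a vertex of the distinguished path

  module _ {x a b : Vertex} {A B F : List Vertex}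
           (left : Even x a A) (right : Odd x b B) (frame : Frame a b F) where

    private
      L₀ : List Vertex
      L₀ = x ∷ A ++ b ∷ B ++ F

    path-flower : Even x u S → Odd u u C → Extension L₀ (S ++ C)
    path-flower {u} {S} {C} st cy with frame-cycle frame
    ... | Q , D , cy′ , D-paired , p = extension (hang st cy right cy′)
      (solve 6 (λ x b S B C Q → x ⊕ S ⊕ b ⊕ B ⊕ C ⊕ Q ⊜ (S ⊕ C) ⊕ x ⊕ b ⊕ B ⊕ Q)
        refl [ x ] [ b ] S B C Q)
      (paired-++ (even-paired left) D-paired)
      (exchange p (solve 7 (λ x b A B F Q D →
          (Q ⊕ D) ⊕ x ⊕ A ⊕ b ⊕ B ⊕ F ⊜ F ⊕ (x ⊕ b ⊕ B ⊕ Q) ⊕ A ⊕ D)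
        refl [ x ] [ b ] A B F Q D))

    -- At odd distance from `x`, the ear replaces the part of the path between `x` and `z`. At even
    -- distance, the ear and this part close an odd cycle at `x`, which `right` joins to a cycle of
    -- the frame.
    ear-left : Odd x z E → z ∈ A → Extension L₀ E
    ear-left {z} {E} e i with even-split left i
    ... | inj₂ (S₁ , S₂ , P₁ , P₂ , p) = extension
      (posy (odd-odd-odd (odd-sym P₂) (odd-sym e) right) frame)
      (solve 8 (λ a b z x S E B F →
          a ⊕ b ⊕ (S ⊕ z ⊕ E ⊕ x ⊕ B) ⊕ F ⊜ E ⊕ a ⊕ b ⊕ S ⊕ z ⊕ x ⊕ B ⊕ F)
        refl [ a ] [ b ] [ z ] [ x ] S₂ E B F)
      (odd-paired P₁)
      (exchange p (solve 9 (λ a b z x S₁ S₂ A B F →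
          (z ⊕ a ⊕ S₁ ⊕ S₂) ⊕ x ⊕ A ⊕ b ⊕ B ⊕ F ⊜ A ⊕ (a ⊕ b ⊕ S₂ ⊕ z ⊕ x ⊕ B ⊕ F) ⊕ S₁)
        refl [ a ] [ b ] [ z ] [ x ] S₁ S₂ A B F))
    ... | inj₁ (S₁ , S₂ , P₁ , P₂ , p) with frame-cycle frame
    ...   | Q , D , cy′ , D-paired , q = extension
      (posy right (barbell (even-odd P₁ (odd-sym e)) cy′))
      (solve 6 (λ x b S B E Q → x ⊕ b ⊕ B ⊕ (S ⊕ E) ⊕ Q ⊜ E ⊕ x ⊕ b ⊕ B ⊕ S ⊕ Q)
        refl [ x ] [ b ] S₁ B E Q)
      (paired-++ (even-paired P₂) D-paired)
      (exchange (++⁺ p q) (solve 9 (λ x b S₁ S₂ A B F Q D →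
          ((S₁ ⊕ S₂) ⊕ Q ⊕ D) ⊕ x ⊕ A ⊕ b ⊕ B ⊕ F ⊜
          (A ⊕ F) ⊕ (x ⊕ b ⊕ B ⊕ S₁ ⊕ Q) ⊕ S₂ ⊕ D)
        refl [ x ] [ b ] S₁ S₂ A B F Q D))

    -- As for `ear-left`, but an odd cycle is now based at `z`, from where the path goes on to `b`.
    ear-right : Odd x z E → z ∈ b ∷ B → Extension L₀ E
    ear-right {z} {E} e i with odd-split-end right i
    ... | inj₂ (S₁ , S₂ , P₁ , P₂ , p) with even-sym left
    ...   | A′ , left′ , q = extension
      (posy (even-odd left′ (odd-even e P₂)) frame)
      (exchange q (solve 8 (λ a b x A A′ S E F →
          (x ⊕ A) ⊕ a ⊕ b ⊕ (A′ ⊕ E ⊕ S) ⊕ F ⊜ (a ⊕ A′) ⊕ E ⊕ x ⊕ A ⊕ b ⊕ S ⊕ F)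
        refl [ a ] [ b ] [ x ] A A′ S₂ E F))
      (odd-paired P₁)
      (exchange p (solve 7 (λ b x S₁ S₂ A B F →
          (S₁ ⊕ S₂) ⊕ x ⊕ A ⊕ b ⊕ B ⊕ F ⊜ B ⊕ (x ⊕ A ⊕ b ⊕ S₂ ⊕ F) ⊕ S₁)
        refl [ b ] [ x ] S₁ S₂ A B F))
    ear-right {z} {E} e i | inj₁ (S₁ , S₂ , P₁ , P₂ , p) with even-sym P₁ | frame-cycle frame
    ... | S′ , P₁′ , r | Q , D , cy′ , D-paired , q = extension
      (posy P₂ (barbell (even-odd P₁′ e) cy′))
      (exchange r (solve 8 (λ x z b S₁ S₂ S′ E Q →
          (x ⊕ S₁) ⊕ z ⊕ b ⊕ S₂ ⊕ (S′ ⊕ E) ⊕ Q ⊜ (z ⊕ S′) ⊕ E ⊕ x ⊕ S₁ ⊕ b ⊕ S₂ ⊕ Q)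
        refl [ x ] [ z ] [ b ] S₁ S₂ S′ E Q))
      (paired-++ (even-paired left) D-paired)
      (exchange (++⁺ p q) (solve 9 (λ x b S₁ S₂ A B F Q D →
          ((S₁ ⊕ S₂) ⊕ Q ⊕ D) ⊕ x ⊕ A ⊕ b ⊕ B ⊕ F ⊜
          (B ⊕ F) ⊕ (x ⊕ S₁ ⊕ b ⊕ S₂ ⊕ Q) ⊕ A ⊕ D)
        refl [ x ] [ b ] S₁ S₂ A B F Q D))

  -- Flowers and ears at a vertex of a cycle of a barbell

  module _ {x a b : Vertex} {A B P C : List Vertex}
           (even : Even x a A) (odd : Odd x a B) (path : Odd a b P) (far : Odd b b C) where

    private
      L₁ : List Vertex
      L₁ = x ∷ A ++ B ++ b ∷ P ++ C

    cycle-flower : Even x u S → Odd u u D → Extension L₁ (S ++ D)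
    cycle-flower {u} {S} {D} st cy = extension (hang st cy (even-odd even path) far)
      (solve 7 (λ x b S A P C D → x ⊕ S ⊕ b ⊕ (A ⊕ P) ⊕ D ⊕ C ⊜ (S ⊕ D) ⊕ x ⊕ A ⊕ b ⊕ P ⊕ C)
        refl [ x ] [ b ] S A P C D)
      (odd-paired odd)
      (solve 6 (λ x b A B P C → x ⊕ A ⊕ B ⊕ b ⊕ P ⊕ C ⊜ (x ⊕ A ⊕ b ⊕ P ⊕ C) ⊕ B)
        refl [ x ] [ b ] A B P C)

    -- At odd distance from `x`, the ear replaces part of the cycle. At even distance it closes a
    -- new odd cycle based at `z`, the path to `b` starts along the rest of the even arc, and the
    -- odd arc is given up.
    ear-even : Odd x z E → z ∈ A → Extension L₁ E
    ear-even {z} {E} e i with even-split even i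
    ... | inj₂ (S₁ , S₂ , P₁ , P₂ , p) = extension
      (posy path (barbell (odd-odd-odd (odd-sym P₂) (odd-sym e) odd) far))
      (solve 9 (λ a b z x S E B P C →
          a ⊕ b ⊕ P ⊕ (S ⊕ z ⊕ E ⊕ x ⊕ B) ⊕ C ⊜ E ⊕ a ⊕ b ⊕ P ⊕ S ⊕ z ⊕ x ⊕ B ⊕ C)
        refl [ a ] [ b ] [ z ] [ x ] S₂ E B P C)
      (odd-paired P₁)
      (exchange p (solve 10 (λ a b z x S₁ S₂ A B P C →
          (z ⊕ a ⊕ S₁ ⊕ S₂) ⊕ x ⊕ A ⊕ B ⊕ b ⊕ P ⊕ C ⊜
          A ⊕ (a ⊕ b ⊕ P ⊕ S₂ ⊕ z ⊕ x ⊕ B ⊕ C) ⊕ S₁)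
        refl [ a ] [ b ] [ z ] [ x ] S₁ S₂ A B P C))
    ... | inj₁ (S₁ , S₂ , P₁ , P₂ , p) with even-sym P₁
    ...   | S′ , P₁′ , q = extension
      (posy (even-odd P₂ path) (barbell (even-odd P₁′ e) far))
      (exchange q (solve 9 (λ x z b S₁ S₂ S′ E P C →
          (x ⊕ S₁) ⊕ z ⊕ b ⊕ (S₂ ⊕ P) ⊕ (S′ ⊕ E) ⊕ C ⊜
          (z ⊕ S′) ⊕ E ⊕ x ⊕ S₁ ⊕ S₂ ⊕ b ⊕ P ⊕ C)
        refl [ x ] [ z ] [ b ] S₁ S₂ S′ E P C))
      (odd-paired odd)
      (exchange p (solve 8 (λ x b S₁ S₂ A B P C →
          (S₁ ⊕ S₂) ⊕ x ⊕ A ⊕ B ⊕ b ⊕ P ⊕ C ⊜ A ⊕ (x ⊕ S₁ ⊕ S₂ ⊕ b ⊕ P ⊕ C) ⊕ B)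
        refl [ x ] [ b ] S₁ S₂ A B P C))

    ear-odd : Odd x z E → z ∈ B → Extension L₁ E
    ear-odd {z} {E} e i with odd-split odd i
    ... | inj₁ (S₁ , S₂ , P₁ , P₂ , p) = extension
      (posy (even-odd even path) (barbell (even-odd P₁ (odd-sym e)) far))
      (solve 7 (λ x b A P S E C →
          x ⊕ b ⊕ (A ⊕ P) ⊕ (S ⊕ E) ⊕ C ⊜ E ⊕ x ⊕ b ⊕ A ⊕ P ⊕ S ⊕ C)
        refl [ x ] [ b ] A P S₁ E C)
      (odd-paired P₂)
      (exchange p (solve 8 (λ x b S₁ S₂ A B P C →
          (S₁ ⊕ S₂) ⊕ x ⊕ A ⊕ B ⊕ b ⊕ P ⊕ C ⊜ B ⊕ (x ⊕ b ⊕ A ⊕ P ⊕ S₁ ⊕ C) ⊕ S₂)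
        refl [ x ] [ b ] S₁ S₂ A B P C))
    ... | inj₂ (S₁ , S₂ , P₁ , P₂ , p) with even-sym even
    ...   | A′ , even′ , q = extension
      (posy path (barbell (even-odd even′ (odd-even e P₂)) far))
      (exchange q (solve 9 (λ x a b A A′ S E P C →
          (x ⊕ A) ⊕ a ⊕ b ⊕ P ⊕ (A′ ⊕ E ⊕ S) ⊕ C ⊜ (a ⊕ A′) ⊕ E ⊕ x ⊕ A ⊕ S ⊕ b ⊕ P ⊕ C)
        refl [ x ] [ a ] [ b ] A A′ S₂ E P C))
      (odd-paired P₁)
      (exchange p (solve 8 (λ x b S₁ S₂ A B P C →
          (S₁ ⊕ S₂) ⊕ x ⊕ A ⊕ B ⊕ b ⊕ P ⊕ C ⊜ B ⊕ (x ⊕ A ⊕ S₂ ⊕ b ⊕ P ⊕ C) ⊕ S₁)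
        refl [ x ] [ b ] S₁ S₂ A B P C))

    -- If `z` is at odd distance from `a`, the cycle is kept with base `x` and the ear replaces the
    -- start of the path. Otherwise the ear closes an odd cycle at `z` through the even arc, and the
    -- odd arc is given up.
    ear-path : Odd x z E → z ∈ b ∷ P → Extension L₁ E
    ear-path {z} {E} e i with odd-split-end path i
    ... | inj₂ (S₁ , S₂ , P₁ , P₂ , p) = extension
      (posy (odd-even e P₂) (barbell (even-odd even (odd-sym odd)) far))
      (solve 7 (λ x b A B S E C →
          x ⊕ b ⊕ (E ⊕ S) ⊕ (A ⊕ B) ⊕ C ⊜ E ⊕ x ⊕ A ⊕ B ⊕ b ⊕ S ⊕ C)
        refl [ x ] [ b ] A B S₂ E C)
      (odd-paired P₁)
      (exchange p (solve 8 (λ x b S₁ S₂ A B P C →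
          (S₁ ⊕ S₂) ⊕ x ⊕ A ⊕ B ⊕ b ⊕ P ⊕ C ⊜ P ⊕ (x ⊕ A ⊕ B ⊕ b ⊕ S₂ ⊕ C) ⊕ S₁)
        refl [ x ] [ b ] S₁ S₂ A B P C))
    ... | inj₁ (S₁ , S₂ , P₁ , P₂ , p) with even-sym (even-even even P₁)
    ...   | S′ , P′ , q = extension
      (posy P₂ (barbell (even-odd P′ e) far))
      (exchange q (solve 9 (λ x z b S₁ S₂ S′ E A C →
          (x ⊕ A ⊕ S₁) ⊕ z ⊕ b ⊕ S₂ ⊕ (S′ ⊕ E) ⊕ C ⊜
          (z ⊕ S′) ⊕ E ⊕ x ⊕ A ⊕ S₁ ⊕ b ⊕ S₂ ⊕ C)
        refl [ x ] [ z ] [ b ] S₁ S₂ S′ E A C))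
      (odd-paired odd)
      (exchange p (solve 8 (λ x b S₁ S₂ A B P C →
          (S₁ ⊕ S₂) ⊕ x ⊕ A ⊕ B ⊕ b ⊕ P ⊕ C ⊜ P ⊕ (x ⊕ A ⊕ S₁ ⊕ b ⊕ S₂ ⊕ C) ⊕ B)
        refl [ x ] [ b ] S₁ S₂ A B P C))

    -- The ear becomes the joining path; the old one is given up, and both cycles get new bases.
    ear-far : Odd x z E → z ∈ C → Extension L₁ E
    ear-far {z} {E} e i with cycle-split far i
    ... | S₁ , S₂ , P₁ , P₂ , p with even-sym P₁
    ...   | S′ , P₁′ , q = extension
      (posy e (barbell (even-odd even (odd-sym odd)) (even-odd P₁′ (odd-sym P₂))))
      (exchange q (solve 9 (λ x z b S₁ S₂ S′ E A B →
          (b ⊕ S₁) ⊕ x ⊕ z ⊕ E ⊕ (A ⊕ B) ⊕ S′ ⊕ S₂ ⊜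
          (z ⊕ S′) ⊕ E ⊕ x ⊕ A ⊕ B ⊕ b ⊕ S₁ ⊕ S₂)
        refl [ x ] [ z ] [ b ] S₁ S₂ S′ E A B))
      (odd-paired path)
      (exchange p (solve 8 (λ x b S₁ S₂ A B P C →
          (S₁ ⊕ S₂) ⊕ x ⊕ A ⊕ B ⊕ b ⊕ P ⊕ C ⊜ C ⊕ (x ⊕ A ⊕ B ⊕ b ⊕ S₁ ⊕ S₂) ⊕ P)
        refl [ x ] [ b ] S₁ S₂ A B P C))

    cycle-ear : Odd x z E → x ≢ z → z ∈ L₁ → Extension L₁ E
    cycle-ear e x≢z (here refl) = ⊥-elim (x≢z refl)
    cycle-ear e x≢z (there i) with ∈-++⁻ A i
    ... | inj₁ j = ear-even e j
    ... | inj₂ j with ∈-++⁻ B j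
    ...   | inj₁ k = ear-odd e k
    ...   | inj₂ k with ∈-++⁻ (b ∷ P) k
    ...     | inj₁ l = ear-path e l
    ...     | inj₂ l = ear-far e l

  -- Positions of a vertex in a posy

  data Location (x : Vertex) (L : List Vertex) : Set where
    on-path  : Even x a A → Odd x b B → Frame a b F → x ∷ A ++ b ∷ B ++ F ↭ L → Location x L
    on-cycle : Even x a A → Odd x a B → Odd a b P → Odd b b C →
               x ∷ A ++ B ++ b ∷ P ++ C ↭ L → Location x L

  location-resp : L ↭ K → Location x L → Location x K
  location-resp p (on-path A B F q)    = on-path A B F (↭-trans q p)
  location-resp p (on-cycle A B P C q) = on-cycle A B P C (↭-trans q p)

  locate-path : Odd a b P → Frame a b F → x ∈ b ∷ P → Location x (a ∷ b ∷ P ++ F)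
  locate-path {a} {b} {P} {F} {x} path frame i with odd-split-end path i
  ... | inj₁ (S₁ , S₂ , P₁ , P₂ , p) with even-sym P₁
  ...   | S′ , P₁′ , q = on-path P₁′ P₂ frame
    (exchange (++⁺ (↭-sym p) q) (solve 8 (λ x a b S₁ S₂ S′ P F →
        (P ⊕ a ⊕ S₁) ⊕ x ⊕ S′ ⊕ b ⊕ S₂ ⊕ F ⊜ ((S₁ ⊕ S₂) ⊕ x ⊕ S′) ⊕ a ⊕ b ⊕ P ⊕ F)
      refl [ x ] [ a ] [ b ] S₁ S₂ S′ P F))
  locate-path {a} {b} {P} {F} {x} path frame i | inj₂ (S₁ , S₂ , P₁ , P₂ , p)
    with even-sym P₂ | frame-swap frame
  ... | S′ , P₂′ , q | F′ , frame′ , r = on-path P₂′ (odd-sym P₁) frame′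
    (exchange (++⁺ (↭-sym p) (++⁺ q (↭-sym r))) (solve 9 (λ x a b S₁ S₂ S′ P F F′ →
        (P ⊕ (b ⊕ S₂) ⊕ F) ⊕ x ⊕ S′ ⊕ a ⊕ S₁ ⊕ F′ ⊜
        ((S₁ ⊕ S₂) ⊕ (x ⊕ S′) ⊕ F′) ⊕ a ⊕ b ⊕ P ⊕ F)
      refl [ x ] [ a ] [ b ] S₁ S₂ S′ P F F′))

  cycle-open : Odd a a C → z ∈ C → ∃₂ λ S T → Even z a S × Odd z a T × z ∷ S ++ T ↭ a ∷ C
  cycle-open {a} {C} {z} P i with cycle-split P i
  ... | S₁ , S₂ , P₁ , P₂ , p with even-sym P₁
  ...   | S′ , P₁′ , q = S′ , S₂ , P₁′ , P₂ , ↭-trans (++⁺ʳ S₂ q) (prep a (↭-sym p))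

  locate-cycle : Odd a b P → Odd a a C → Odd b b D → x ∈ C → Location x (a ∷ b ∷ P ++ C ++ D)
  locate-cycle {a} {b} {P} {C} {D} {x} path near far i with cycle-open near i
  ... | S , T , P₁ , P₂ , p = on-cycle P₁ P₂ path far
    (exchange p (solve 8 (λ x a b S T P C D →
        (a ⊕ C) ⊕ x ⊕ S ⊕ T ⊕ b ⊕ P ⊕ D ⊜ (x ⊕ S ⊕ T) ⊕ a ⊕ b ⊕ P ⊕ C ⊕ D)
      refl [ x ] [ a ] [ b ] S T P C D))

  -- In a K₄ every edge can be the distinguished path, so each vertex comes to lie on that path;
  -- only the cycles of a barbell need `on-cycle`.
  locate-frame : Odd a b P → Frame a b F → x ∈ F → Location x (a ∷ b ∷ P ++ F)
  locate-frame {a} {b} {P} path (barbell {C = C} {D = D} near far) i with ∈-++⁻ C i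
  ... | inj₁ j = locate-cycle path near far j
  ... | inj₂ j = location-resp
    (solve 5 (λ a b P C D → b ⊕ a ⊕ P ⊕ D ⊕ C ⊜ a ⊕ b ⊕ P ⊕ C ⊕ D) refl [ a ] [ b ] P C D)
    (locate-cycle (odd-sym path) far near j)
  locate-frame {a} {b} {P} {x = x} path
    (k4 {c} {ac} {d} {ad} {bc} {bd} {cd} Pac Pad Pbc Pbd Pcd) = go
    where
    at-ac : x ∈ c ∷ ac → Location x _
    at-ac j = location-resp
      (solve 10 (λ a b c d P ac ad bc bd cd →
          a ⊕ c ⊕ ac ⊕ b ⊕ d ⊕ P ⊕ ad ⊕ bc ⊕ cd ⊕ bd ⊜
          a ⊕ b ⊕ P ⊕ c ⊕ d ⊕ ac ⊕ ad ⊕ bc ⊕ bd ⊕ cd)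
        refl [ a ] [ b ] [ c ] [ d ] P ac ad bc bd cd)
      (locate-path Pac (k4 path Pad (odd-sym Pbc) Pcd Pbd) j)
    at-ad : x ∈ d ∷ ad → Location x _
    at-ad j = location-resp
      (solve 10 (λ a b c d P ac ad bc bd cd →
          a ⊕ d ⊕ ad ⊕ b ⊕ c ⊕ P ⊕ ac ⊕ bd ⊕ cd ⊕ bc ⊜
          a ⊕ b ⊕ P ⊕ c ⊕ d ⊕ ac ⊕ ad ⊕ bc ⊕ bd ⊕ cd)
        refl [ a ] [ b ] [ c ] [ d ] P ac ad bc bd cd)
      (locate-path Pad (k4 path Pac (odd-sym Pbd) (odd-sym Pcd) Pbc) j)
    at-bc : x ∈ c ∷ bc → Location x _
    at-bc j = location-resp
      (solve 10 (λ a b c d P ac ad bc bd cd →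
          b ⊕ c ⊕ bc ⊕ a ⊕ d ⊕ P ⊕ bd ⊕ ac ⊕ cd ⊕ ad ⊜
          a ⊕ b ⊕ P ⊕ c ⊕ d ⊕ ac ⊕ ad ⊕ bc ⊕ bd ⊕ cd)
        refl [ a ] [ b ] [ c ] [ d ] P ac ad bc bd cd)
      (locate-path Pbc (k4 (odd-sym path) Pbd (odd-sym Pac) Pcd Pad) j)
    at-bd : x ∈ d ∷ bd → Location x _
    at-bd j = location-resp
      (solve 10 (λ a b c d P ac ad bc bd cd →
          b ⊕ d ⊕ bd ⊕ a ⊕ c ⊕ P ⊕ bc ⊕ ad ⊕ cd ⊕ ac ⊜
          a ⊕ b ⊕ P ⊕ c ⊕ d ⊕ ac ⊕ ad ⊕ bc ⊕ bd ⊕ cd)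
        refl [ a ] [ b ] [ c ] [ d ] P ac ad bc bd cd)
      (locate-path Pbd (k4 (odd-sym path) Pbc (odd-sym Pad) (odd-sym Pcd) Pac) j)
    at-cd : x ∈ d ∷ cd → Location x _
    at-cd j = location-resp
      (solve 10 (λ a b c d P ac ad bc bd cd →
          c ⊕ d ⊕ cd ⊕ a ⊕ b ⊕ ac ⊕ bc ⊕ ad ⊕ bd ⊕ P ⊜
          a ⊕ b ⊕ P ⊕ c ⊕ d ⊕ ac ⊕ ad ⊕ bc ⊕ bd ⊕ cd)
        refl [ a ] [ b ] [ c ] [ d ] P ac ad bc bd cd)
      (locate-path Pcd (k4 (odd-sym Pac) (odd-sym Pbc) (odd-sym Pad) (odd-sym Pbd) path) j)
    go : x ∈ c ∷ d ∷ ac ++ ad ++ bc ++ bd ++ cd → Location x _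
    go (here e)         = at-ac (here e)
    go (there (here e)) = at-ad (here e)
    go (there (there i)) with ∈-++⁻ ac i
    ... | inj₁ j = at-ac (there j)
    ... | inj₂ i with ∈-++⁻ ad i
    ...   | inj₁ j = at-ad (there j)
    ...   | inj₂ i with ∈-++⁻ bc i
    ...     | inj₁ j = at-bc (there j)
    ...     | inj₂ i with ∈-++⁻ bd i
    ...       | inj₁ j = at-bd (there j)
    ...       | inj₂ j = at-cd (there j)

  locate : Posy L → x ∈ L → Location x L
  locate {x = x} (a , b , P , F , path , frame , p) i = location-resp p (go (∈-resp-↭ (↭-sym p) i))
    where
    go : x ∈ a ∷ b ∷ P ++ F → Location x (a ∷ b ∷ P ++ F)
    go (here refl) = on-path even-nil path frame refl
    go (there i) with ∈-++⁻ (b ∷ P) i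
    ... | inj₁ j = locate-path path frame j
    ... | inj₂ j = locate-frame path frame j

  -- Ears from the distinguished path to the rest of a K₄

  module _ {x a b c d : Vertex} {A B ac ad bc bd cd : List Vertex}
           (left : Even x a A) (right : Odd x b B)
           (Pac : Odd a c ac) (Pad : Odd a d ad) (Pbc : Odd b c bc) (Pbd : Odd b d bd)
           (Pcd : Odd c d cd) where

    private
      L₂ : List Vertex
      L₂ = x ∷ A ++ b ∷ B ++ c ∷ d ∷ ac ++ ad ++ bc ++ bd ++ cd

    -- If `z` is at even distance from `a`, the ear closes an odd cycle through `x`, `a` and `z`,
    -- and `right` joins it to the triangle on `b`, `c`, `d`. Otherwise a K₄ with corners `x`, `b`,
    -- `c`, `d` arises.
    k4-ear-ac : Odd x z E → z ∈ c ∷ ac → Extension L₂ E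
    k4-ear-ac {z} {E} e i with odd-split-end Pac i
    ... | inj₁ (S₁ , S₂ , P₁ , P₂ , p) = extension
      (posy right (barbell (even-odd (even-even left P₁) (odd-sym e))
                           (odd-odd-odd Pbc Pcd (odd-sym Pbd))))
      (solve 11 (λ x b c d A S₁ E B bc bd cd →
          x ⊕ b ⊕ B ⊕ ((A ⊕ S₁) ⊕ E) ⊕ bc ⊕ c ⊕ cd ⊕ d ⊕ bd ⊜
          E ⊕ x ⊕ b ⊕ B ⊕ A ⊕ S₁ ⊕ bc ⊕ c ⊕ cd ⊕ d ⊕ bd)
        refl [ x ] [ b ] [ c ] [ d ] A S₁ E B bc bd cd)
      (paired-++ (odd-paired P₂) (odd-paired Pad))
      (exchange p (solve 13 (λ x b c d A S₁ S₂ B ac ad bc bd cd →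
          (S₁ ⊕ S₂) ⊕ x ⊕ A ⊕ b ⊕ B ⊕ c ⊕ d ⊕ ac ⊕ ad ⊕ bc ⊕ bd ⊕ cd ⊜
          ac ⊕ (x ⊕ b ⊕ B ⊕ A ⊕ S₁ ⊕ bc ⊕ c ⊕ cd ⊕ d ⊕ bd) ⊕ S₂ ⊕ ad)
        refl [ x ] [ b ] [ c ] [ d ] A S₁ S₂ B ac ad bc bd cd))
    ... | inj₂ (S₁ , S₂ , P₁ , P₂ , p) = extension
      (posy (odd-even e P₂) (k4 right (even-odd left Pad) (odd-sym Pbc) Pcd Pbd))
      (solve 12 (λ x b c d A S₂ E B ad bc bd cd →
          x ⊕ c ⊕ (E ⊕ S₂) ⊕ b ⊕ d ⊕ B ⊕ (A ⊕ ad) ⊕ bc ⊕ cd ⊕ bd ⊜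
          E ⊕ x ⊕ c ⊕ S₂ ⊕ b ⊕ d ⊕ B ⊕ A ⊕ ad ⊕ bc ⊕ cd ⊕ bd)
        refl [ x ] [ b ] [ c ] [ d ] A S₂ E B ad bc bd cd)
      (odd-paired P₁)
      (exchange p (solve 13 (λ x b c d A S₁ S₂ B ac ad bc bd cd →
          (S₁ ⊕ S₂) ⊕ x ⊕ A ⊕ b ⊕ B ⊕ c ⊕ d ⊕ ac ⊕ ad ⊕ bc ⊕ bd ⊕ cd ⊜
          ac ⊕ (x ⊕ c ⊕ S₂ ⊕ b ⊕ d ⊕ B ⊕ A ⊕ ad ⊕ bc ⊕ cd ⊕ bd) ⊕ S₁)
        refl [ x ] [ b ] [ c ] [ d ] A S₁ S₂ B ac ad bc bd cd))

    -- If `z` is at even distance from `b`, the new K₄ has corners `z`, `a`, `c`, `d`, and the path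
    -- from `x` to `b` is given up. Otherwise its corners are `x`, `z`, `b`, `d`, and the path from
    -- `a` to `c` is given up.
    k4-ear-bc : Odd x z E → z ∈ bc → Extension L₂ E
    k4-ear-bc {z} {E} e i with odd-split Pbc i
    ... | inj₁ (S₁ , S₂ , P₁ , P₂ , p) with even-sym left | even-sym P₁
    ...   | A′ , left′ , q | S′ , P₁′ , r = extension
      (posy (odd-even (odd-sym e) left′) (k4 P₂ (even-odd P₁′ Pbd) Pac Pad Pcd))
      (exchange (++⁺ q r) (solve 16 (λ x a b c d z A A′ S₁ S₂ S′ E ac ad bd cd →
          ((x ⊕ A) ⊕ b ⊕ S₁) ⊕
          z ⊕ a ⊕ (E ⊕ A′) ⊕ c ⊕ d ⊕ S₂ ⊕ (S′ ⊕ bd) ⊕ ac ⊕ ad ⊕ cd ⊜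
          ((a ⊕ A′) ⊕ z ⊕ S′) ⊕
          E ⊕ x ⊕ A ⊕ b ⊕ S₁ ⊕ c ⊕ d ⊕ S₂ ⊕ bd ⊕ ac ⊕ ad ⊕ cd)
        refl [ x ] [ a ] [ b ] [ c ] [ d ] [ z ] A A′ S₁ S₂ S′ E ac ad bd cd))
      (odd-paired right)
      (exchange p (solve 13 (λ x b c d A B S₁ S₂ ac ad bc bd cd →
          (S₁ ⊕ S₂) ⊕ x ⊕ A ⊕ b ⊕ B ⊕ c ⊕ d ⊕ ac ⊕ ad ⊕ bc ⊕ bd ⊕ cd ⊜
          bc ⊕ (x ⊕ A ⊕ b ⊕ S₁ ⊕ c ⊕ d ⊕ S₂ ⊕ bd ⊕ ac ⊕ ad ⊕ cd) ⊕ B)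
        refl [ x ] [ b ] [ c ] [ d ] A B S₁ S₂ ac ad bc bd cd))
    k4-ear-bc {z} {E} e i | inj₂ (S₁ , S₂ , P₁ , P₂ , p) with even-sym P₂
    ... | S′ , P₂′ , q = extension
      (posy e (k4 right (even-odd left Pad) (odd-sym P₁) (even-odd P₂′ Pcd) Pbd))
      (exchange q (solve 14 (λ x z b c d A B S₁ S₂ S′ E ad bd cd →
          (c ⊕ S₂) ⊕ x ⊕ z ⊕ E ⊕ b ⊕ d ⊕ B ⊕ (A ⊕ ad) ⊕ S₁ ⊕ (S′ ⊕ cd) ⊕ bd ⊜
          (z ⊕ S′) ⊕ E ⊕ x ⊕ c ⊕ S₂ ⊕ b ⊕ d ⊕ B ⊕ A ⊕ ad ⊕ S₁ ⊕ cd ⊕ bd)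
        refl [ x ] [ z ] [ b ] [ c ] [ d ] A B S₁ S₂ S′ E ad bd cd))
      (odd-paired Pac)
      (exchange p (solve 13 (λ x b c d A B S₁ S₂ ac ad bc bd cd →
          (S₁ ⊕ S₂) ⊕ x ⊕ A ⊕ b ⊕ B ⊕ c ⊕ d ⊕ ac ⊕ ad ⊕ bc ⊕ bd ⊕ cd ⊜
          bc ⊕ (x ⊕ c ⊕ S₂ ⊕ b ⊕ d ⊕ B ⊕ A ⊕ ad ⊕ S₁ ⊕ cd ⊕ bd) ⊕ ac)
        refl [ x ] [ b ] [ c ] [ d ] A B S₁ S₂ ac ad bc bd cd))

    -- The new corners are `x`, `z`, `b`, `d`: the path from `z` to `b` runs through `c`, the one
    -- from `x` to `d` through `a`, and the path from `a` to `c` is given up.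
    k4-ear-cd : Even c z S → Odd z d T → cd ↭ S ++ T → Odd x z E → Extension L₂ E
    k4-ear-cd {z} {S} {T} {E} P₁ P₂ p e with even-sym P₁
    ... | S′ , P₁′ , q = extension
      (posy e (k4 right (even-odd left Pad) (even-odd P₁′ (odd-sym Pbc)) P₂ Pbd))
      (exchange q (solve 14 (λ x z b c d A B S T S′ E ad bc bd →
          (c ⊕ S) ⊕ x ⊕ z ⊕ E ⊕ b ⊕ d ⊕ B ⊕ (A ⊕ ad) ⊕ (S′ ⊕ bc) ⊕ T ⊕ bd ⊜
          (z ⊕ S′) ⊕ E ⊕ x ⊕ c ⊕ S ⊕ b ⊕ d ⊕ B ⊕ A ⊕ ad ⊕ bc ⊕ T ⊕ bd)
        refl [ x ] [ z ] [ b ] [ c ] [ d ] A B S T S′ E ad bc bd))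
      (odd-paired Pac)
      (exchange p (solve 13 (λ x b c d A B S T ac ad bc bd cd →
          (S ⊕ T) ⊕ x ⊕ A ⊕ b ⊕ B ⊕ c ⊕ d ⊕ ac ⊕ ad ⊕ bc ⊕ bd ⊕ cd ⊜
          cd ⊕ (x ⊕ c ⊕ S ⊕ b ⊕ d ⊕ B ⊕ A ⊕ ad ⊕ bc ⊕ T ⊕ bd) ⊕ ac)
        refl [ x ] [ b ] [ c ] [ d ] A B S T ac ad bc bd cd))

  k4-ear : Even x a A → Odd x b B →
    Odd a c ac → Odd a d ad → Odd b c bc → Odd b d bd → Odd c d cd →
    Odd x z E → z ∈ c ∷ d ∷ ac ++ ad ++ bc ++ bd ++ cd →
    Extension (x ∷ A ++ b ∷ B ++ c ∷ d ∷ ac ++ ad ++ bc ++ bd ++ cd) E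
  k4-ear {x} {A = A} {b} {B} {c} {ac} {d} {ad} {bc} {bd} {cd} {z} {E}
         left right Pac Pad Pbc Pbd Pcd e = go
    where
    L₂ : List Vertex
    L₂ = x ∷ A ++ b ∷ B ++ c ∷ d ∷ ac ++ ad ++ bc ++ bd ++ cd
    flip : Extension (x ∷ A ++ b ∷ B ++ d ∷ c ∷ ad ++ ac ++ bd ++ bc ++ cd) E → Extension L₂ E
    flip = extension-resp (solve 11 (λ x b c d A B ac ad bc bd cd →
        x ⊕ A ⊕ b ⊕ B ⊕ d ⊕ c ⊕ ad ⊕ ac ⊕ bd ⊕ bc ⊕ cd ⊜
        x ⊕ A ⊕ b ⊕ B ⊕ c ⊕ d ⊕ ac ⊕ ad ⊕ bc ⊕ bd ⊕ cd)
      refl [ x ] [ b ] [ c ] [ d ] A B ac ad bc bd cd)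
    at-ac : z ∈ c ∷ ac → Extension L₂ E
    at-ac = k4-ear-ac left right Pac Pad Pbc Pbd Pcd e
    at-ad : z ∈ d ∷ ad → Extension L₂ E
    at-ad j = flip (k4-ear-ac left right Pad Pac Pbd Pbc (odd-sym Pcd) e j)
    at-cd : z ∈ cd → Extension L₂ E
    at-cd j with odd-split Pcd j
    ... | inj₁ (S₁ , S₂ , P₁ , P₂ , p) = k4-ear-cd left right Pac Pad Pbc Pbd Pcd P₁ P₂ p e
    ... | inj₂ (S₁ , S₂ , P₁ , P₂ , p) =
      flip (k4-ear-cd left right Pad Pac Pbd Pbc (odd-sym Pcd) P₂ (odd-sym P₁)
              (↭-trans p (++-comm S₁ S₂)) e)
    go : z ∈ c ∷ d ∷ ac ++ ad ++ bc ++ bd ++ cd → Extension L₂ E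
    go (here p)         = at-ac (here p)
    go (there (here p)) = at-ad (here p)
    go (there (there i)) with ∈-++⁻ ac i
    ... | inj₁ j = at-ac (there j)
    ... | inj₂ i with ∈-++⁻ ad i
    ...   | inj₁ j = at-ad (there j)
    ...   | inj₂ i with ∈-++⁻ bc i
    ...     | inj₁ j = k4-ear-bc left right Pac Pad Pbc Pbd Pcd e j
    ...     | inj₂ i with ∈-++⁻ bd i
    ...       | inj₁ j = flip (k4-ear-bc left right Pad Pac Pbd Pbc (odd-sym Pcd) e j)
    ...       | inj₂ j = at-cd j

  -- The ear is read backwards, from the vertex `z` on the cycle, so that `cycle-ear` applies.
  barbell-ear : Odd a b P → Odd a a C → Odd b b D →
    Odd x z E → x ≢ z → x ∈ a ∷ b ∷ P ++ C ++ D → z ∈ C → Extension (a ∷ b ∷ P ++ C ++ D) E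
  barbell-ear {a} {b} {P} {C} {D} {x} {z} path near far e x≢z j i with cycle-open near i
  ... | S , T , P₁ , P₂ , p = extension-resp L↭
    (cycle-ear P₁ P₂ path far (odd-sym e) (λ z≡x → x≢z (sym z≡x)) (∈-resp-↭ (↭-sym L↭) j))
    where
    L↭ : z ∷ S ++ T ++ b ∷ P ++ D ↭ a ∷ b ∷ P ++ C ++ D
    L↭ = exchange p (solve 8 (λ z a b S T P C D →
        (a ⊕ C) ⊕ z ⊕ S ⊕ T ⊕ b ⊕ P ⊕ D ⊜ (z ⊕ S ⊕ T) ⊕ a ⊕ b ⊕ P ⊕ C ⊕ D)
      refl [ z ] [ a ] [ b ] S T P C D)

  frame-ear : Even x a A → Odd x b B → Frame a b F → Odd x z E → x ≢ z → z ∈ F →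
    Extension (x ∷ A ++ b ∷ B ++ F) E
  frame-ear left right (k4 Pac Pad Pbc Pbd Pcd) e _ i = k4-ear left right Pac Pad Pbc Pbd Pcd e i
  frame-ear {x} {a} {A} {b} {B} left right (barbell {C = C} {D = D} near far) e x≢z i
    with even-sym left | ∈-++⁻ C i
  ... | A′ , left′ , p | inj₁ j = extension-resp L↭
    (barbell-ear (even-odd left′ right) near far e x≢z (∈-resp-↭ (↭-sym L↭) (here refl)) j)
    where
    L↭ : a ∷ b ∷ (A′ ++ B) ++ C ++ D ↭ x ∷ A ++ b ∷ B ++ C ++ D
    L↭ = exchange p (solve 8 (λ x a b A A′ B C D →
        (x ⊕ A) ⊕ a ⊕ b ⊕ (A′ ⊕ B) ⊕ C ⊕ D ⊜ (a ⊕ A′) ⊕ x ⊕ A ⊕ b ⊕ B ⊕ C ⊕ D)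
      refl [ x ] [ a ] [ b ] A A′ B C D)
  ... | A′ , left′ , p | inj₂ j = extension-resp L↭
    (barbell-ear (odd-even (odd-sym right) left′) far near e x≢z
      (∈-resp-↭ (↭-sym L↭) (here refl)) j)
    where
    L↭ : b ∷ a ∷ (B ++ A′) ++ D ++ C ↭ x ∷ A ++ b ∷ B ++ C ++ D
    L↭ = exchange p (solve 8 (λ x a b A A′ B C D →
        (x ⊕ A) ⊕ b ⊕ a ⊕ (B ⊕ A′) ⊕ D ⊕ C ⊜ (a ⊕ A′) ⊕ x ⊕ A ⊕ b ⊕ B ⊕ C ⊕ D)
      refl [ x ] [ a ] [ b ] A A′ B C D)

  posy-flower : Posy L → x ∈ L → Even x u S → Odd u u C → Extension L (S ++ C)
  posy-flower Q i st cy with locate Q i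
  ... | on-path A B F p    = extension-resp p (path-flower A B F st cy)
  ... | on-cycle A B P C p = extension-resp p (cycle-flower A B P C st cy)

  posy-ear : Posy L → x ∈ L → z ∈ L → x ≢ z → Odd x z E → Extension L E
  posy-ear Q i j x≢z e with locate Q i
  ... | on-cycle A B P C p =
    extension-resp p (cycle-ear A B P C e x≢z (∈-resp-↭ (↭-sym p) j))
  ... | on-path {A = A} {b = b} {B = B} left right frame p with ∈-resp-↭ (↭-sym p) j
  ...   | here z≡x = ⊥-elim (x≢z (sym z≡x))
  ...   | there k with ∈-++⁻ A k
  ...     | inj₁ l = extension-resp p (ear-left left right frame e l)
  ...     | inj₂ l with ∈-++⁻ (b ∷ B) l
  ...       | inj₁ m = extension-resp p (ear-right left right frame e m)
  ...       | inj₂ m = extension-resp p (frame-ear left right frame e x≢z m)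

  -- Spreading a posy over the graph

  Covered : Vertex → Set
  Covered v = ∃[ L ] Posy L × Part L × v ∈ L

  odd-ends-paired : Odd x y S → Paired (x ∷ y ∷ S)
  odd-ends-paired {x} (_ , _ , A , e , p) = paired-resp (prep _ (prep _ p)) (go A e)
    where
    go : ∀ {y z S} → Arm x y S → y ~ z → Paired (x ∷ z ∷ S)
    go stop e = paired-edge e
    go {z = z} (snoc {S = S} {u = u} {v = v} A e f) g =
      paired-resp (solve 5 (λ x z u v S → (z ⊕ v) ⊕ x ⊕ u ⊕ S ⊜ x ⊕ z ⊕ v ⊕ u ⊕ S)
                    refl [ x ] [ z ] [ u ] [ v ] S)
        (paired-++ (paired-edge (~-sym g)) (go A e))

  frame-paired : Frame a b F → Paired F
  frame-paired (barbell P Q) = paired-++ (odd-paired P) (odd-paired Q)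
  frame-paired (k4 {c} {ac} {d} {ad} {bc} {bd} {cd} P Q R S T) =
    paired-resp (solve 7 (λ c d ac ad bc bd cd →
        (c ⊕ d ⊕ cd) ⊕ ac ⊕ ad ⊕ bc ⊕ bd ⊜ c ⊕ d ⊕ ac ⊕ ad ⊕ bc ⊕ bd ⊕ cd)
      refl [ c ] [ d ] ac ad bc bd cd)
      (paired-++ (odd-ends-paired T) (paired-++ (odd-paired P)
        (paired-++ (odd-paired Q) (paired-++ (odd-paired R) (odd-paired S)))))

  posy-paired : Posy L → Paired L
  posy-paired (_ , _ , _ , _ , P , F , p) =
    paired-resp p (paired-++ (odd-ends-paired P) (frame-paired F))

  part-matching : Adj T → T ↭ L → ((R , _) : Part L) →
    ∃[ M ] Along M T × Saturated M R × L ++ R ↭ allFin order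
  part-matching {T} A p (R , (R′ , B , q) , r) = M , proj₁ split , (_ , proj₂ split , q) , r
    where
    total = ↭-trans (++⁺ p q) r
    M = matching (adj-++ A B) total
    split = along-++⁻ M A (matching-along (adj-++ A B) total)

  covered : Extension L E → Part (L ++ E) → s ∈ E → Covered s
  covered {L} {E} (K , D , Q , D-paired , p) part i =
    _ , Q , part-drop (E ++ K) D-paired (part-resp
      (exchange p (solve 4 (λ L E K D → (K ⊕ D) ⊕ L ⊕ E ⊜ L ⊕ (E ⊕ K) ⊕ D) refl L E K D)) part) ,
    ∈-++⁺ˡ i

  module _ (N : PerfectMatching) (connected : StronglyConnected N) where

    grow : Covered t → t ~ s → Covered s
    grow {t} {s} (L , Q , part , t∈L) t~s with s ∈? L
    ... | yes s∈L = L , Q , part , s∈L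
    ... | no s∉L with posy-paired Q
    ...   | T , A , p with part-matching A p part
    ...   | M , along , R-sat , L++R
      with leave M L-sat R-sat L++R (strongly-connected-any N connected M (mate M s) t)
             (mate-∉L M L-sat R-sat L++R s∉L) t∈L
      where L-sat = T , along , p
    ...   | w , out with exit M (T , along , p) R-sat L++R t~s out
    ...     | inj₁ (flower st cy part′ , i) = covered (posy-flower Q t∈L st cy) part′ i
    ...     | inj₂ (ear walk part′ , i) with t ≟ mate M w
    -- An ear that returns to `t` is an odd cycle at `t`, hence a flower with empty stem.
    ...       | yes refl = covered (posy-flower Q t∈L even-nil walk) part′ i
    ...       | no t≢w   = covered (posy-ear Q t∈L w∈L t≢w walk) part′ i
      where
      entry : ∀ {u w} → Outside M (T , along , p) R-sat L++R u w → w ∈ L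
      entry (enter _ _ w∈L) = w∈L
      entry (stay _ _ out)  = entry out
      w∈L = saturated-mate M (T , along , p) (entry out)

    grow-walk : Covered t → Star _~_ t s → Covered s
    grow-walk c ε       = c
    grow-walk c (e ◅ p) = grow-walk (grow c e) p

  arcs-walk : ∀ M → Star (Arc M) x y → Star _~_ x y
  arcs-walk M ε = ε
  arcs-walk M (_◅_ {j = y} a p) = a ◅ ~-sym (mate-edge M y) ◅ arcs-walk M p

  -- A first posy

  SomeCovered : Set
  SomeCovered = ∃[ v ] Covered v

  posy-covered : Posy K → Paired D → L ↭ K ++ D → Part L → SomeCovered
  posy-covered {K = K} Q@(a , _ , _ , _ , _ , _ , p) D-paired q part =
    a , K , Q , part-drop K D-paired (part-resp q part) , ∈-resp-↭ p (here refl)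

  unique-disjoint : ∀ S → Unique (S ++ T) → v ∈ S → v ∉ T
  unique-disjoint (_ ∷ S) (p ∷ U) (here refl) j = All.lookup p (∈-++⁺ʳ S j) refl
  unique-disjoint (_ ∷ S) (p ∷ U) (there i)   j = unique-disjoint S U i j

  -- The vertices of the list of an arm at even, respectively odd, distance from
  -- its ends.
  evens odds : List Vertex → List Vertex
  evens []          = []
  evens (v ∷ [])    = v ∷ []
  evens (v ∷ u ∷ S) = v ∷ evens S
  odds []           = []
  odds (v ∷ [])     = []
  odds (v ∷ u ∷ S)  = u ∷ odds S

  evens-odds : ∀ S → S ↭ evens S ++ odds S
  evens-odds []          = refl
  evens-odds (v ∷ [])    = refl
  evens-odds (v ∷ u ∷ S) = ↭-trans (prep v (prep u (evens-odds S)))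
    (solve 4 (λ v u e o → v ⊕ u ⊕ e ⊕ o ⊜ (v ⊕ e) ⊕ u ⊕ o) refl [ v ] [ u ] (evens S) (odds S))

  mate-even : ∀ M → Along M S → v ∈ evens S → mate M v ∈ odds S
  mate-even M (pair refl A) (here refl) = here refl
  mate-even M (pair _ A)    (there i)   = there (mate-even M A i)

  odds-split : Arm p q T → u ∈ odds T →
    ∃₂ λ S₁ S₂ → Odd p u S₁ × Odd u q S₂ × T ↭ u ∷ q ∷ S₁ ++ S₂
  odds-split (snoc A e f) (here refl) =
    _ , [] , (_ , _ , A , e , refl) , edge f , swap _ _ (↭-sym (++-identityʳ _))
  odds-split {u = u} (snoc {y} {R} {w} {v} A e f) (there i) with odds-split A i
  ... | S₁ , S₂ , P₁ , P₂ , p =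
    S₁ , _ , P₁ , odd-even P₂ (_ , snoc stop (~-sym f) (~-sym e) , refl) ,
    exchange p (solve 7 (λ u y w v R S₁ S₂ →
        (u ⊕ y ⊕ S₁ ⊕ S₂) ⊕ v ⊕ w ⊕ R ⊜ R ⊕ u ⊕ v ⊕ S₁ ⊕ S₂ ⊕ y ⊕ w)
      refl [ u ] [ y ] [ w ] [ v ] R S₁ S₂)

  -- Two vertices at odd distance from the ends of an arm, with `u` met before `z`; the stretch
  -- between them is even.
  record Between (p q u z : Vertex) (T : List Vertex) : Set where
    constructor between
    field
      {lower middle upper} : List Vertex
      first  : Odd p u lower
      second : Even u z middle
      third  : Odd z q upper
      all    : T ↭ u ∷ q ∷ lower ++ middle ++ upper

  between-last : Arm p y R → y ~ w → w ~ v → z ∈ odds R → Between p v z w (v ∷ w ∷ R)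
  between-last {y = y} {R} {w} {v} {z} A e f j with odds-split A j
  ... | S₁ , S₂ , P₁ , P₂ , p = between P₁ (odd-edge P₂ e) (edge f)
    (↭-trans
      (exchange p (solve 7 (λ z y w v R S₁ S₂ →
          (z ⊕ y ⊕ S₁ ⊕ S₂) ⊕ v ⊕ w ⊕ R ⊜ R ⊕ z ⊕ v ⊕ S₁ ⊕ w ⊕ y ⊕ S₂)
        refl [ z ] [ y ] [ w ] [ v ] R S₁ S₂))
      (prep z (prep v (++⁺ˡ S₁ (↭-sym (++-identityʳ _))))))

  between-snoc : Between p y u z R → y ~ w → w ~ v → Between p v u z (v ∷ w ∷ R)
  between-snoc {y = y} {u} {z} {R} {w} {v} (between {S₁} {S₂} {S₃} P₁ P₂ P₃ p) e f =
    between P₁ P₂ (odd-even P₃ (_ , snoc stop (~-sym f) (~-sym e) , refl))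
      (exchange p (solve 8 (λ u y w v R S₁ S₂ S₃ →
          (u ⊕ y ⊕ S₁ ⊕ S₂ ⊕ S₃) ⊕ v ⊕ w ⊕ R ⊜ R ⊕ u ⊕ v ⊕ S₁ ⊕ S₂ ⊕ S₃ ⊕ y ⊕ w)
        refl [ u ] [ y ] [ w ] [ v ] R S₁ S₂ S₃))

  odds-between : Arm p q T → u ∈ odds T → z ∈ odds T → u ≢ z →
    Between p q u z T ⊎ Between p q z u T
  odds-between (snoc A e f) (here refl) (here refl) u≢z = ⊥-elim (u≢z refl)
  odds-between (snoc A e f) (here refl) (there j)   _   = inj₂ (between-last A e f j)
  odds-between (snoc A e f) (there i)   (here refl) _   = inj₁ (between-last A e f i)
  odds-between (snoc A e f) (there i)   (there j)   u≢z with odds-between A i j u≢z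
  ... | inj₁ r = inj₁ (between-snoc r e f)
  ... | inj₂ r = inj₂ (between-snoc r e f)

  arm-last : Arm x y S → x ≢ y → y ∈ S
  arm-last stop         x≢y = ⊥-elim (x≢y refl)
  arm-last (snoc _ _ _) _   = here refl

  -- Thetas

  -- An even cycle U₁ ++ U₂ and an odd path joining two vertices of it at even
  -- distance.
  record Theta (n : ℕ) : Set where
    constructor theta
    field
      {from to}     : Vertex
      {U₁ U₂ I}     : List Vertex
      from≢to       : from ≢ to
      arm₁          : Arm from to U₁
      arm₂          : Arm to from U₂
      chord         : Odd from to I
      length-chord  : length I ≡ n
      part          : Part (U₁ ++ U₂ ++ I)

  module _ {p u q : Vertex} {S₁ S₂ F O : List Vertex}
           (pu : Odd p u S₁) (uq : Odd u q S₂) (pq : Even p q (q ∷ F)) (chord : Odd p q O) where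

    private
      L₃ : List Vertex
      L₃ = p ∷ q ∷ u ∷ S₁ ++ S₂ ++ F ++ O

    -- The chord and the arm avoiding `u` close an odd cycle at `p`; the flower is joined to it by
    -- the odd path from `u` to `p`.
    theta-flower : Flower u L₃ → SomeCovered
    theta-flower (flower {β} {S} {C} st cy part) = posy-covered
      (hang st cy (odd-sym pu) (odd-even chord pq)) (odd-paired uq)
      (solve 9 (λ p q u S₁ S₂ F O S C →
          (p ⊕ q ⊕ u ⊕ S₁ ⊕ S₂ ⊕ F ⊕ O) ⊕ S ⊕ C ⊜
          (u ⊕ S ⊕ p ⊕ S₁ ⊕ C ⊕ O ⊕ q ⊕ F) ⊕ S₂)
        refl [ p ] [ q ] [ u ] S₁ S₂ F O S C)
      part

    -- The new theta has ends `z` and `q`. Its even arms run through `p` and the old arm avoiding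
    -- `u`, and through `u` and the ear; its chord is the odd part of the old chord beyond `z`. This
    -- is shorter because `z` differs from `p`.
    theta-shrink : p ≢ z → z ≢ q → Odd u z E → Even p z O₁ → Odd z q O₂ → O ↭ O₁ ++ O₂ →
      Part (L₃ ++ E) → ∃[ m ] m < length O × Theta m
    theta-shrink {z} {E} {O₁} {O₂} p≢z z≢q e pz zq r part with even-sym pz
    ... | O′ , zp , s with even-even zp pq | odd-odd (odd-sym uq) e
    ...   | T , A , t | T′ , A′ , t′ = length O₂ , shorter ,
      theta z≢q A A′ zq refl (part-drop (T ++ T′ ++ O₂) (odd-paired pu) (part-resp
        (exchange (++⁺ r (++⁺ (↭-sym s) (++⁺ (↭-sym t) (↭-sym t′))))
          (solve 14 (λ p q u z S₁ S₂ F E O O₁ O₂ O′ T T′ →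
              ((O₁ ⊕ O₂) ⊕ (z ⊕ O′) ⊕ T ⊕ T′) ⊕ (p ⊕ q ⊕ u ⊕ S₁ ⊕ S₂ ⊕ F ⊕ O) ⊕ E ⊜
              (O ⊕ (p ⊕ O₁) ⊕ (O′ ⊕ q ⊕ F) ⊕ z ⊕ u ⊕ S₂ ⊕ E) ⊕ (T ⊕ T′ ⊕ O₂) ⊕ S₁)
            refl [ p ] [ q ] [ u ] [ z ] S₁ S₂ F E O O₁ O₂ O′ T T′)) part))
      where
      shorter : length O₂ < length O
      shorter with even-tail pz p≢z
      ... | O₁′ , h = begin-strict
        length O₂                 <⟨ s≤s (m≤n+m (length O₂) (length O₁′)) ⟩
        suc (length O₁′ + length O₂) ≡⟨ length-++ (z ∷ O₁′) ⟨
        length ((z ∷ O₁′) ++ O₂)  ≡⟨ ↭-length (++⁺ʳ O₂ h) ⟨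
        length (O₁ ++ O₂)         ≡⟨ ↭-length r ⟨
        length O                  ∎
        where open ≤-Reasoning

  module _ {p q : Vertex} {T₁ T₂ O : List Vertex}
           (p≢q : p ≢ q) (arm₁ : Arm p q T₁) (arm₂ : Arm q p T₂) (chord : Odd p q O)
           (T-unique : Unique ((T₁ ++ T₂) ++ O)) where

    private
      second : ∃[ F ] Even p q (q ∷ F) × Even q p (p ∷ F) × T₂ ↭ p ∷ F
      second with even-tail (_ , arm₂ , refl) (λ q≡p → p≢q (sym q≡p)) | even-sym (_ , arm₂ , refl)
      ... | F , r | _ , E , s =
        F , even-resp (drop-∷ (↭-trans s (↭-trans (prep q r) (swap q p refl)))) E ,
        (_ , arm₂ , r) , r

      normal : u ∈ odds T₁ → ∃₂ λ S₁ S₂ → ∃[ F ] Odd p u S₁ × Odd u q S₂ ×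
        Even p q (q ∷ F) × Even q p (p ∷ F) × T₁ ++ T₂ ++ O ↭ p ∷ q ∷ u ∷ S₁ ++ S₂ ++ F ++ O
      normal {u} i with odds-split arm₁ i | second
      ... | S₁ , S₂ , P₁ , P₂ , r | F , E , E′ , s = S₁ , S₂ , F , P₁ , P₂ , E , E′ ,
        exchange (++⁺ r s) (solve 9 (λ p q u S₁ S₂ F O T₁ T₂ →
            ((u ⊕ q ⊕ S₁ ⊕ S₂) ⊕ p ⊕ F) ⊕ T₁ ⊕ T₂ ⊕ O ⊜
            (T₁ ⊕ T₂) ⊕ p ⊕ q ⊕ u ⊕ S₁ ⊕ S₂ ⊕ F ⊕ O)
          refl [ p ] [ q ] [ u ] S₁ S₂ F O T₁ T₂)

    -- The even stretch from `u` to `z` and the ear close an odd cycle at `u`; the chord and the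
    -- other arm close one at `p`.
    theta-ear-same : Between p q u z T₁ → Odd z u E → Part ((T₁ ++ T₂ ++ O) ++ E) → SomeCovered
    theta-ear-same {u} {z} {E} (between {S₁} {S₂} {S₃} P₁ P₂ P₃ r) e part with second
    ... | F , E₂ , _ , s = posy-covered
      (posy (odd-sym P₁) (barbell (even-odd P₂ e) (odd-even chord E₂)))
      (odd-paired P₃)
      (exchange (++⁺ r s) (solve 11 (λ p q u S₁ S₂ S₃ F O E T₁ T₂ →
          ((u ⊕ q ⊕ S₁ ⊕ S₂ ⊕ S₃) ⊕ p ⊕ F) ⊕ (T₁ ⊕ T₂ ⊕ O) ⊕ E ⊜
          (T₁ ⊕ T₂) ⊕ (u ⊕ p ⊕ S₁ ⊕ (S₂ ⊕ E) ⊕ O ⊕ q ⊕ F) ⊕ S₃)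
        refl [ p ] [ q ] [ u ] S₁ S₂ S₃ F O E T₁ T₂))
      part

    -- A K₄ with corners `u`, `z`, `p`, `q`: the ear and the chord are opposite edges, the four
    -- halves of the arms are the others.
    theta-ear-across : u ∈ odds T₁ → z ∈ odds T₂ → Odd u z E →
      Part ((T₁ ++ T₂ ++ O) ++ E) → SomeCovered
    theta-ear-across {u} {z} {E} i j e part with odds-split arm₁ i | odds-split arm₂ j
    ... | S₁ , S₂ , P₁ , P₂ , r | R₁ , R₂ , Q₁ , Q₂ , s = posy-covered
      (posy e (k4 (odd-sym P₁) P₂ Q₂ (odd-sym Q₁) chord)) paired-[]
      (exchange (++⁺ r s) (solve 12 (λ p q u z S₁ S₂ R₁ R₂ O E T₁ T₂ →
          ((u ⊕ q ⊕ S₁ ⊕ S₂) ⊕ z ⊕ p ⊕ R₁ ⊕ R₂) ⊕ (T₁ ⊕ T₂ ⊕ O) ⊕ E ⊜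
          (T₁ ⊕ T₂) ⊕ (u ⊕ z ⊕ E ⊕ p ⊕ q ⊕ S₁ ⊕ S₂ ⊕ R₂ ⊕ R₁ ⊕ O) ⊕ id)
        refl [ p ] [ q ] [ u ] [ z ] S₁ S₂ R₁ R₂ O E T₁ T₂))
      part

    theta-ear-chord : u ∈ odds T₁ → z ∈ O → Odd u z E →
      Part ((T₁ ++ T₂ ++ O) ++ E) → ∃[ m ] m < length O × Theta m
    theta-ear-chord {u} {z} {E} i j e part with normal i | odd-split chord j
    ... | S₁ , S₂ , F , pu , uq , pq , qp , r | inj₁ (O₁ , O₂ , pz , zq , s) =
      theta-shrink pu uq pq chord (off p∈) (λ z≡q → off q∈ (sym z≡q)) e pz zq s
        (part-resp (++⁺ʳ E r) part)
      where
      p∈ = ∈-++⁺ʳ T₁ (arm-last arm₂ (λ q≡p → p≢q (sym q≡p)))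
      q∈ = ∈-++⁺ˡ (arm-last arm₁ p≢q)
      off : ∀ {v} → v ∈ T₁ ++ T₂ → v ≢ z
      off v∈ refl = unique-disjoint (T₁ ++ T₂) T-unique v∈ j
    ... | S₁ , S₂ , F , pu , uq , pq , qp , r | inj₂ (O₁ , O₂ , pz , qz , s) =
      theta-shrink (odd-sym uq) (odd-sym pu) qp (odd-sym chord)
        (off q∈) (λ z≡p → off p∈ (sym z≡p)) e qz (odd-sym pz) (↭-trans s (++-comm O₁ O₂))
        (part-resp (↭-trans (++⁺ʳ E r)
          (solve 8 (λ p q u S₁ S₂ F O E → (p ⊕ q ⊕ u ⊕ S₁ ⊕ S₂ ⊕ F ⊕ O) ⊕ E ⊜
                                          (q ⊕ p ⊕ u ⊕ S₂ ⊕ S₁ ⊕ F ⊕ O) ⊕ E)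
            refl [ p ] [ q ] [ u ] S₁ S₂ F O E)) part)
      where
      p∈ = ∈-++⁺ʳ T₁ (arm-last arm₂ (λ q≡p → p≢q (sym q≡p)))
      q∈ = ∈-++⁺ˡ (arm-last arm₁ p≢q)
      off : ∀ {v} → v ∈ T₁ ++ T₂ → v ≢ z
      off v∈ refl = unique-disjoint (T₁ ++ T₂) T-unique v∈ j

    theta-exit : u ∈ odds T₁ → z ∈ odds T₁ ⊎ z ∈ odds T₂ ⊎ z ∈ O →
      Flower u (T₁ ++ T₂ ++ O) ⊎ Ear u z (T₁ ++ T₂ ++ O) →
      SomeCovered ⊎ ∃[ m ] m < length O × Theta m
    theta-exit {u} i _ (inj₁ f) = inj₁ (bloom f)
      where
      bloom : Flower u (T₁ ++ T₂ ++ O) → SomeCovered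
      bloom (flower st cy part) with normal i
      ... | _ , _ , _ , pu , uq , pq , _ , r =
        theta-flower pu uq pq chord (flower st cy (part-resp (++⁺ʳ _ r) part))
    theta-exit {u} {z} i j (inj₂ (ear walk part)) with u ≟ z
    ... | yes refl = theta-exit i j (inj₁ (flower even-nil walk part))
    ... | no u≢z with j
    ...   | inj₂ (inj₂ k) = inj₂ (theta-ear-chord i k walk part)
    ...   | inj₂ (inj₁ k) = inj₁ (theta-ear-across i k walk part)
    ...   | inj₁ k with odds-between arm₁ i k u≢z
    ...     | inj₁ r = inj₁ (theta-ear-same r (odd-sym walk) part)
    ...     | inj₂ r = inj₁ (theta-ear-same r walk part)

  arm-last-even : Arm x y S → x ≢ y → y ∈ evens S
  arm-last-even stop         x≢y = ⊥-elim (x≢y refl)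
  arm-last-even (snoc _ _ _) _   = here refl

  arm-odd : Arm x y S → x ≢ y → ∃[ u ] u ∈ odds S
  arm-odd stop         x≢y = ⊥-elim (x≢y refl)
  arm-odd (snoc _ _ _) _   = _ , here refl

  module _ (N : PerfectMatching) (connected : StronglyConnected N) where

    -- `W` collects the vertices of both arms at odd distance from the ends, and `M` matches the
    -- other arm vertices into `W`. A directed path entering the theta at `v` outside `W` therefore
    -- lands, in the graph, on a vertex of `W` or of the chord, and `theta-exit` handles exactly
    -- these cases.
    theta-step : ∀ {n} → Theta n → SomeCovered ⊎ ∃[ m ] m < n × Theta m
    theta-step (theta {p} {q} {T₁} {T₂} {O} p≢q arm₁ arm₂ chord@(_ , O′ , A , _ , r) refl part)
      with part-matching (adj-++ (arm-adj arm₁) (adj-++ (arm-adj arm₂) (arm-adj A)))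
             (++⁺ˡ T₁ (++⁺ˡ T₂ r)) part
    ... | M , along , R-sat , L++R with along-++⁻ M (arm-adj arm₁) along
    ...   | along₁ , along₂₃ with along-++⁻ M (arm-adj arm₂) along₂₃ | arm-odd arm₁ p≢q
    ...     | along₂ , _ | u₀ , u₀∈ =
      finish (cross M L-sat R-sat L++R W (strongly-connected-any N connected M u₀ q)
               (∈-++⁺ˡ u₀∈) (∈-++⁺ˡ (arm-last arm₁ p≢q)) q∉W)
      where
      Θ W : List Vertex
      Θ = T₁ ++ T₂ ++ O
      W = odds T₁ ++ odds T₂
      L-sat = _ , along , ++⁺ˡ T₁ (++⁺ˡ T₂ r)
      unique : Unique Θ
      unique = part-unique part
      T-unique : Unique ((T₁ ++ T₂) ++ O)
      T-unique = unique-resp (↭-sym (++-assoc T₁ T₂ O)) unique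
      T-unique′ : Unique ((T₂ ++ T₁) ++ O)
      T-unique′ = unique-resp (++⁺ʳ O (++-comm T₁ T₂)) T-unique
      q∉W : q ∉ W
      q∉W = unique-disjoint (evens T₁ ++ evens T₂)
        (unique-resp (exchange (++⁺ (evens-odds T₁) (evens-odds T₂))
            (solve 7 (λ T₁ T₂ O e₁ e₂ o₁ o₂ → ((e₁ ⊕ o₁) ⊕ e₂ ⊕ o₂) ⊕ T₁ ⊕ T₂ ⊕ O ⊜
                                              (T₁ ⊕ T₂) ⊕ (e₁ ⊕ e₂) ⊕ (o₁ ⊕ o₂) ⊕ O)
              refl T₁ T₂ O (evens T₁) (evens T₂) (odds T₁) (odds T₂))) unique)
        (∈-++⁺ˡ (arm-last-even arm₁ p≢q)) ∘ ∈-++⁺ˡ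
      locate-white : ∀ {v} → v ∉ W → v ∈ Θ →
        mate M v ∈ odds T₁ ⊎ mate M v ∈ odds T₂ ⊎ mate M v ∈ O
      locate-white {v} v∉W v∈L with ∈-++⁻ T₁ (saturated-mate M L-sat v∈L)
      ... | inj₁ i with ∈-++⁻ (evens T₁) (∈-resp-↭ (evens-odds T₁) i)
      ...   | inj₁ j = ⊥-elim (v∉W (∈-++⁺ˡ
                         (subst (_∈ odds T₁) (mate-mate M v) (mate-even M along₁ j))))
      ...   | inj₂ j = inj₁ j
      locate-white {v} v∉W v∈L | inj₂ i with ∈-++⁻ T₂ i
      ...   | inj₂ j = inj₂ (inj₂ j)
      ...   | inj₁ i′ with ∈-++⁻ (evens T₂) (∈-resp-↭ (evens-odds T₂) i′)
      ...     | inj₁ j = ⊥-elim (v∉W (∈-++⁺ʳ (odds T₁)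
                           (subst (_∈ odds T₂) (mate-mate M v) (mate-even M along₂ j))))
      ...     | inj₂ j = inj₂ (inj₁ j)
      flip : ∀ {I} → Part (Θ ++ I) → Part ((T₂ ++ T₁ ++ O) ++ I)
      flip {I} = part-resp (solve 4 (λ T₁ T₂ O I → (T₁ ⊕ T₂ ⊕ O) ⊕ I ⊜ (T₂ ⊕ T₁ ⊕ O) ⊕ I)
                             refl T₁ T₂ O I)
      flip-exit : ∀ {x z} → Flower x Θ ⊎ Ear x z Θ →
                  Flower x (T₂ ++ T₁ ++ O) ⊎ Ear x z (T₂ ++ T₁ ++ O)
      flip-exit (inj₁ (flower st cy part)) = inj₁ (flower st cy (flip part))
      flip-exit (inj₂ (ear walk part))     = inj₂ (ear walk (flip part))
      flip-white : ∀ {z} → z ∈ odds T₁ ⊎ z ∈ odds T₂ ⊎ z ∈ O →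
                   z ∈ odds T₂ ⊎ z ∈ odds T₁ ⊎ z ∈ O
      flip-white (inj₁ i)        = inj₂ (inj₁ i)
      flip-white (inj₂ (inj₁ i)) = inj₁ i
      flip-white (inj₂ (inj₂ i)) = inj₂ (inj₂ i)
      finish : (∃₂ λ x v → x ∈ W × v ∈ Θ × v ∉ W × (Flower x Θ ⊎ Ear x (mate M v) Θ)) →
        SomeCovered ⊎ ∃[ m ] m < length O × Theta m
      finish (x , v , x∈W , v∈L , v∉W , e) with ∈-++⁻ (odds T₁) x∈W
      ... | inj₁ i = theta-exit p≢q arm₁ arm₂ chord T-unique i (locate-white v∉W v∈L) e
      ... | inj₂ i = theta-exit (λ q≡p → p≢q (sym q≡p)) arm₂ arm₁ (odd-sym chord) T-unique′ i
        (flip-white (locate-white v∉W v∈L)) (flip-exit e)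

    theta-covered : ∀ {n} → Acc _<_ n → Theta n → SomeCovered
    theta-covered (acc rs) θ with theta-step θ
    ... | inj₁ c               = c
    ... | inj₂ (m , m<n , θ′) = theta-covered (rs m<n) θ′

    -- Lollipops

    lollipop-flower : Odd b b C → b ~ b′ → Flower b′ (b ∷ b′ ∷ C) → SomeCovered
    lollipop-flower {b} {C} {b′} cycle e (flower {S₀} {C₀} st cy part) =
      posy-covered (hang st cy (edge (~-sym e)) cycle) paired-[]
        (solve 5 (λ b b′ C S D → (b ⊕ b′ ⊕ C) ⊕ S ⊕ D ⊜ (b′ ⊕ S ⊕ b ⊕ D ⊕ C) ⊕ id)
          refl [ b ] [ b′ ] C _ _)
        part

    -- An ear to `z` on the cycle gives a theta with ends `b` and `z`: one arm runs through `b′` and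
    -- the ear, the other arm is the even arc of the cycle, and the chord is the odd arc.
    lollipop-exit : Odd b b C → b ~ b′ → z ∈ b ∷ b′ ∷ C → z ≢ b →
      Flower b′ (b ∷ b′ ∷ C) ⊎ Ear b′ z (b ∷ b′ ∷ C) → SomeCovered
    lollipop-exit cycle e i z≢b (inj₁ f) = lollipop-flower cycle e f
    lollipop-exit cycle e (here z≡b) z≢b (inj₂ _) = ⊥-elim (z≢b z≡b)
    lollipop-exit cycle e (there (here refl)) z≢b (inj₂ (ear walk part)) =
      lollipop-flower cycle e (flower even-nil walk part)
    lollipop-exit {b} {C} {b′} {z} cycle e (there (there i)) z≢b (inj₂ (ear {E} walk part))
      with cycle-split cycle i
    ... | S₁ , S₂ , bz , zb , r with odd-odd (edge e) walk | even-sym bz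
    ...   | T₁ , arm₁ , s | S′ , (T₂ , arm₂ , t) , t′ =
      theta-covered (<-wellFounded _) (theta (λ b≡z → z≢b (sym b≡z)) arm₁ arm₂ (odd-sym zb) refl
        (part-resp (exchange (++⁺ r (++⁺ (↭-sym s) (++⁺ (↭-sym t) (↭-sym t′))))
          (solve 10 (λ b b′ z C S₁ S₂ S′ E T₁ T₂ →
              ((S₁ ⊕ S₂) ⊕ T₁ ⊕ T₂ ⊕ z ⊕ S′) ⊕ (b ⊕ b′ ⊕ C) ⊕ E ⊜
              (C ⊕ (z ⊕ b′ ⊕ E) ⊕ S′ ⊕ b ⊕ S₁) ⊕ T₁ ⊕ T₂ ⊕ S₂)
            refl [ b ] [ b′ ] [ z ] C S₁ S₂ S′ E T₁ T₂))
          part))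

    -- Since `M` matches `b` with `b′`, a path that comes back at a vertex other than `b′` gives an
    -- ear that does not end in `b`. An ear to `b` would only close an even cycle with the edge
    -- `b ~ b′`.
    lollipop-covered : Odd b b C → b ~ b′ → Part (b ∷ b′ ∷ C) → SomeCovered
    lollipop-covered {b} {C} {b′} cycle@(_ , C′ , A , _ , r) e part
      with part-matching (pair e (arm-adj A)) (prep b (prep b′ r)) part
    ... | M , along@(pair mb _) , R-sat , L++R
      with cross M L-sat R-sat L++R (b′ ∷ []) (strongly-connected-any N connected M b′ b)
             (here refl) (here refl) b∉
      where
      L-sat = _ , along , prep b (prep b′ r)
      b∉ : b ∉ b′ ∷ []
      b∉ (here b≡b′) = ~-irrefl b≡b′ e
    ...   | x , v , here refl , v∈L , v∉W , exit =
      lollipop-exit cycle e (saturated-mate M L-sat v∈L) z≢b exit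
      where
      L-sat = _ , along , prep b (prep b′ r)
      z≢b : mate M v ≢ b
      z≢b z≡b = v∉W (here (trans (sym (mate-mate M v)) (trans (cong (mate M) z≡b) mb)))

    -- `n` is fuel: the recursion removes `v` together with its mate from the middle of the list.
    saturated-closed : ∀ M n S → length S < n → Unique S → (∀ {v} → v ∈ S → mate M v ∈ S) →
      Saturated M S
    saturated-closed M (suc n) []      _         _       _      = [] , [] , refl
    saturated-closed M (suc n) (v ∷ S) (s≤s ∣S∣<) (v∉ ∷ U) closed = go (closed (here refl))
      where
      go : mate M v ∈ v ∷ S → Saturated M (v ∷ S)
      go (here m≡v) = ⊥-elim (~-irrefl (sym m≡v) (mate-edge M v))
      go (there i) with ∈-∃++ i
      ... | S₁ , S₂ , refl =
        saturated-resp M (prep v (↭-sym (shift _ S₁ S₂)))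
          (saturated-++ M (_ , pair refl [] , refl)
            (saturated-closed M n (S₁ ++ S₂) shorter U₂ closed′))
        where
        shifted : Unique (mate M v ∷ S₁ ++ S₂)
        shifted = unique-resp (shift (mate M v) S₁ S₂) U
        U₂ : Unique (S₁ ++ S₂)
        U₂ with shifted
        ... | _ ∷ U′ = U′
        mate∉ : mate M v ∉ S₁ ++ S₂
        mate∉ = Unique[x∷xs]⇒x∉xs shifted
        shorter : length (S₁ ++ S₂) < n
        shorter = ≤-trans (n≤1+n _)
          (subst (_< n) (↭-length (shift (mate M v) S₁ S₂)) ∣S∣<)
        closed′ : ∀ {w} → w ∈ S₁ ++ S₂ → mate M w ∈ S₁ ++ S₂
        closed′ {w} j with closed (there (∈-resp-↭ (↭-sym (shift _ S₁ S₂)) (there j)))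
        ... | here mw≡v =
          ⊥-elim (mate∉ (subst (_∈ S₁ ++ S₂) (trans (sym (mate-mate M w)) (cong (mate M) mw≡v)) j))
        ... | there k with ∈-resp-↭ (shift _ S₁ S₂) k
        ...   | there k′ = k′
        ...   | here mw≡mv = ⊥-elim (All.lookup v∉
          (∈-resp-↭ (↭-sym (shift _ S₁ S₂)) (there j)) (mate-injective M (sym mw≡mv)))

    -- The pendant edge of the lollipop is the last edge of the stem or, if the stem is empty,
    -- `u ~ v`.
    flower-covered : u ~ v → Flower u (u ∷ v ∷ []) → SomeCovered
    flower-covered e (flower (_ , stop , r) cycle part) = lollipop-covered cycle e
      (part-resp (prep _ (prep _ (++⁺ʳ _ (↭-sym r)))) part)
    flower-covered {u} {v} e
      (flower {cycle₀ = C} (_ , snoc {S = S} {u = w} {v = β} A _ f , r) cycle part) =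
      lollipop-covered cycle (~-sym f) (part-drop (β ∷ w ∷ C)
        (paired-++ (paired-edge e) (_ , arm-adj A , refl))
        (part-resp (exchange (↭-sym r) (solve 7 (λ u v w β S R C →
            (β ⊕ w ⊕ S) ⊕ (u ⊕ v) ⊕ R ⊕ C ⊜ R ⊕ (β ⊕ w ⊕ C) ⊕ (u ⊕ v) ⊕ S)
          refl [ u ] [ v ] [ w ] [ β ] S _ C)) part))

    some-covered : Vertex → SomeCovered
    some-covered v with extract N (saturated-closed N _ (allFin order) (n<1+n _) (allFin⁺ order)
                                    (λ {w} _ → ∈-allFin (mate N w))) (∈-allFin v)
    ... | T , R-sat , p
      with cross N (_ , pair refl [] , refl) R-sat (↭-sym p) (v ∷ []) (connected v (mate N v))
             (here refl) (there (here refl)) m∉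
      where
      m∉ : mate N v ∉ v ∷ []
      m∉ (here m≡v) = ~-irrefl (sym m≡v) (mate-edge N v)
    ... | x , w , here refl , here w≡v , w∉ , _ = ⊥-elim (w∉ (here w≡v))
    ... | x , w , here refl , there (here refl) , w∉ , inj₁ f = flower-covered (mate-edge N v) f
    -- The ear ends in the mate of the mate of `v`, that is, in `v`, so it is an odd cycle.
    ... | x , w , here refl , there (here refl) , w∉ , inj₂ (ear walk part) =
      flower-covered (mate-edge N v)
        (flower even-nil (subst (λ z → Odd v z _) (mate-mate N v) walk) part)

    all-covered : ∀ v → Covered v
    all-covered v with some-covered v
    ... | t , c = grow-walk N connected c (arcs-walk N (connected t v))

  -- Tposies from posies

  asMatching : PerfectMatching → Matching G
  asMatching M = record
    { Matched    = λ u v → mate M u ≡ v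
    ; matched?   = λ u v → mate M u ≟ v
    ; symmetric  = λ { refl → mate-mate M _ }
    ; isEdge     = λ { refl → mate-edge M _ }
    ; functional = λ { refl e → e }
    }

  -- Perfect matchings are maximum

  unique-⊆-length : Unique S → (∀ {v} → v ∈ S → v ∈ T) → length S ≤ length T
  unique-⊆-length {[]}    U       _   = z≤n
  unique-⊆-length {v ∷ S} (v∉ ∷ U) S⊆T with ∈-∃++ (S⊆T (here refl))
  ... | T₁ , T₂ , refl = subst (suc (length S) ≤_) (sym (↭-length (shift v T₁ T₂)))
    (s≤s (unique-⊆-length U S⊆))
    where
    S⊆ : ∀ {w} → w ∈ S → w ∈ T₁ ++ T₂
    S⊆ i with ∈-resp-↭ (shift v T₁ T₂) (S⊆T (there i))
    ... | here refl = ⊥-elim (All.lookup v∉ i refl)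
    ... | there j   = j

  ends : List (Vertex × Vertex) → List Vertex
  ends []             = []
  ends ((u , v) ∷ es) = u ∷ v ∷ ends es

  length-ends : ∀ es → length (ends es) ≡ 2 * length es
  length-ends []       = refl
  length-ends (_ ∷ es) =
    trans (cong (λ n → suc (suc n)) (length-ends es)) (sym (*-suc 2 (length es)))

  ∈-ends⁻ : ∀ {es w} → w ∈ ends es → ∃₂ λ u v → (u , v) ∈ es × (w ≡ u ⊎ w ≡ v)
  ∈-ends⁻ {_ ∷ es} (here e)         = _ , _ , here refl , inj₁ e
  ∈-ends⁻ {_ ∷ es} (there (here e)) = _ , _ , here refl , inj₂ e
  ∈-ends⁻ {_ ∷ es} (there (there i)) with ∈-ends⁻ {es} i
  ... | u , v , j , e = u , v , there j , e

  ∈-ends⁺ : ∀ {es u v} → (u , v) ∈ es → u ∈ ends es × v ∈ ends es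
  ∈-ends⁺ (here refl) = here refl , there (here refl)
  ∈-ends⁺ (there i) with ∈-ends⁺ i
  ... | j , k = there (there j) , there (there k)

  module _ (N : Matching G) where
    open Matching N

    edges : List (Vertex × Vertex)
    edges = filter (λ (u , v) → (u <ᶠ? v) ×-dec matched? u v)
                   (cartesianProduct (allFin order) (allFin order))

    edges-unique : Unique edges
    edges-unique = filter⁺ _ (cartesianProduct⁺ (allFin⁺ order) (allFin⁺ order))

    ends-unique : ∀ {es} → Unique es → (∀ {u v} → (u , v) ∈ es → u <ᶠ v × Matched u v) →
      Unique (ends es)
    ends-unique {[]}            _        _ = []
    ends-unique {(u , v) ∷ es} (e∉ ∷ U) h =
      (u≢v ∷ All.tabulate (λ i u≡w → meet i (inj₁ (sym u≡w)))) ∷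
      All.tabulate (λ i v≡w → meet i (inj₂ (sym v≡w))) ∷
      ends-unique U (λ i → h (there i))
      where
      u<v = proj₁ (h (here refl))
      u~v = proj₂ (h (here refl))
      u≢v : u ≢ v
      u≢v refl = ~-irrefl refl (isEdge u~v)
      meet : ∀ {w} → w ∈ ends es → w ≡ u ⊎ w ≡ v → ⊥
      meet i e with ∈-ends⁻ i
      ... | u′ , v′ , j , e′ with h (there j)
      ...   | u′<v′ , u′~v′ = clash e e′
        where
        clash : ∀ {w} → w ≡ u ⊎ w ≡ v → w ≡ u′ ⊎ w ≡ v′ → ⊥
        clash (inj₁ refl) (inj₁ refl) with functional u~v u′~v′
        ... | refl = All.lookup e∉ j refl
        clash (inj₁ refl) (inj₂ refl) with functional u~v (symmetric u′~v′)
        ... | refl = <-asym u<v u′<v′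
        clash (inj₂ refl) (inj₁ refl) with functional (symmetric u~v) u′~v′
        ... | refl = <-asym u<v u′<v′
        clash (inj₂ refl) (inj₂ refl) with functional (symmetric u~v) (symmetric u′~v′)
        ... | refl = All.lookup e∉ j refl

    edge-sound : (u , v) ∈ edges → u <ᶠ v × Matched u v
    edge-sound i = proj₂ (∈-filter⁻ (λ (u , v) → (u <ᶠ? v) ×-dec matched? u v)
                           {xs = cartesianProduct (allFin order) (allFin order)} i)

    edge-complete : u <ᶠ v → Matched u v → (u , v) ∈ edges
    edge-complete u<v u~v = ∈-filter⁺ (λ (u , v) → (u <ᶠ? v) ×-dec matched? u v)
      (∈-cartesianProduct⁺ (∈-allFin _) (∈-allFin _)) (u<v , u~v)

  -- Ends are counted instead of edges: those of any matching are distinct, and those of a perfect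
  -- one exhaust the vertices.
  perfect-maximum : ∀ M → IsMaximum G (asMatching M)
  perfect-maximum M N = *-cancelˡ-≤ 2 (begin
    2 * length (edges N)           ≡⟨ length-ends (edges N) ⟨
    length (ends (edges N))        ≤⟨ unique-⊆-length
                                        (ends-unique N (edges-unique N) (edge-sound N))
                                        (λ _ → cover _) ⟩
    length (ends (edges M′))       ≡⟨ length-ends (edges M′) ⟩
    2 * length (edges M′)          ∎)
    where
    open ≤-Reasoning
    M′ = asMatching M
    cover : ∀ v → v ∈ ends (edges M′)
    cover v with <-cmp v (mate M v)
    ... | tri< v<m _ _ = proj₁ (∈-ends⁺ (edge-complete M′ v<m refl))
    ... | tri≈ _ v≡m _ = ⊥-elim (~-irrefl v≡m (mate-edge M v))
    ... | tri> _ _ m<v = proj₂ (∈-ends⁺ (edge-complete M′ m<v (mate-mate M v)))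

  -- Walks, blossoms and Tposies from arms

  -- The walk goes backwards, so that its vertices appear in the very order in which an arm lists
  -- them.
  toWalk : Arm x y S → y ~ z → Walk z x
  toWalk stop         e = ~-sym e ◅ ε
  toWalk (snoc A e f) g = ~-sym g ◅ ~-sym f ◅ toWalk A e

  vertices-toWalk : (A : Arm x y S) (e : y ~ z) → vertices (toWalk A e) ≡ z ∷ S ++ x ∷ []
  vertices-toWalk stop         e = refl
  vertices-toWalk (snoc A e f) g = cong (λ l → _ ∷ _ ∷ l) (vertices-toWalk A e)

  sources-toWalk : (A : Arm x y S) (e : y ~ z) → map proj₁ (steps (toWalk A e)) ≡ z ∷ S
  sources-toWalk stop         e = refl
  sources-toWalk (snoc A e f) g = cong (λ l → _ ∷ _ ∷ l) (sources-toWalk A e)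

  half : Arm x y S → ℕ
  half stop         = 0
  half (snoc A _ _) = suc (half A)

  length-toWalk : (A : Arm x y S) (e : y ~ z) → ∣ toWalk A e ∣ ≡ suc (2 * half A)
  length-toWalk stop         e = refl
  length-toWalk (snoc A e f) g =
    cong suc (trans (cong suc (length-toWalk A e)) (sym (*-suc 2 (half A))))

  step-ends : (w : Walk x y) → (u , v) ∈ steps w → u ∈ vertices w × v ∈ vertices w
  step-ends (_ ◅ ε)       (here refl) = here refl , there (here refl)
  step-ends (_ ◅ (_ ◅ w)) (here refl) = here refl , there (here refl)
  step-ends (_ ◅ w)       (there i) with step-ends w i
  ... | j , k = there j , there k

  module _ (M : PerfectMatching) where

    private
      matched : Matching G
      matched = asMatching M

      joins? : (e : Vertex × Vertex) → Dec (mate M (proj₁ e) ≡ proj₂ e)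
      joins? (u , v) = mate M u ≟ v

    alternating-∷ : ∀ {e es} → AnyMaybe (InM matched) (head es) → ¬ InM matched e →
      Linked (ExactlyOneInM matched) es → Linked (ExactlyOneInM matched) (e ∷ es)
    alternating-∷ {es = _ ∷ _} (just m) n l = inj₂ (n , m) ∷ l

    last-∷ : ∀ {e es} → AnyMaybe (InM matched) (last es) → AnyMaybe (InM matched) (last (e ∷ es))
    last-∷ {es = _ ∷ _} m = m

    mm-toWalk : (A : Arm x y S) (e : y ~ z) → Along M (z ∷ S ++ x ∷ []) →
      Unique (z ∷ S ++ x ∷ []) → MMAlternating matched (toWalk A e)
    mm-toWalk stop         e (pair m _) _ = [-] , just m , just m
    mm-toWalk {z = z} (snoc {u = u} {v} A e f) g (pair m B) ((_ ∷ z≢u ∷ _) ∷ _ ∷ U)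
      with mm-toWalk A e B U
    ... | alt , first , final =
      inj₁ (m , free) ∷ alternating-∷ first free alt , just m ,
      last-∷ {z , v} {_ ∷ steps (toWalk A e)} (last-∷ {es = steps (toWalk A e)} final)
      where
      free : mate M v ≢ u
      free q = z≢u (trans (sym (mate-mate M _)) (trans (cong (mate M) m) q))

    -- The induction needs the first edge to be unmatched, which is why the mate of `z` is kept off
    -- the rest of the walk. After two steps the new start `u` has its mate `v` behind it, so the
    -- condition persists.
    count-toWalk : (A : Arm x y S) (e : y ~ z) → Along M S → Unique S → x ∉ S →
      mate M z ∉ S → mate M z ≢ x →
      length (filter joins? (steps (toWalk A e))) ≡ half A
    count-toWalk {x} {z = z} stop e _ _ _ _ m≢x
      rewrite filter-reject joins? {x = z , x} {xs = []} m≢x = refl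
    count-toWalk {x} {z = z} (snoc {S = S} {u} {v} A e f) g (pair m B) (v∉ ∷ _ ∷ U) x∉ m∉ m≢x
      rewrite filter-reject joins? {x = z , v} {xs = (v , u) ∷ steps (toWalk A e)}
                (λ q → m∉ (here q))
            | filter-accept joins? {x = v , u} {xs = steps (toWalk A e)} m =
      cong suc (count-toWalk A e B U (λ i → x∉ (there (there i))) u-out u≢x)
      where
      mu : mate M u ≡ v
      mu = trans (cong (mate M) (sym m)) (mate-mate M v)
      u-out : mate M u ∉ S
      u-out i = All.lookup v∉ (there (subst (_∈ S) mu i)) refl
      u≢x : mate M u ≢ x
      u≢x q = x∉ (here (trans (sym q) mu))

    closed-walk : (A : Arm b y S) (e : y ~ b) → Along M S → Unique (b ∷ S) → mate M b ∉ S →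
      Blossom matched
    closed-walk {b} {S = S} A e B U m∉ = record
      { cycle    = toWalk A e
      ; isCycle  = long A e , subst Unique (sym (sources-toWalk A e)) U
      ; k        = half A
      ; length≡  = length-toWalk A e
      ; matched≡ = count-toWalk A e B (AllPairs.tail U) (Unique[x∷xs]⇒x∉xs U) m∉
                     (λ m≡b → ~-irrefl (sym m≡b) (mate-edge M b))
      }
      where
      long : ∀ {y S} (A : Arm b y S) (e : y ~ b) → 3 ≤ ∣ toWalk A e ∣
      long stop                  e = ⊥-elim (~-irrefl refl e)
      long (snoc stop e f)         g = s≤s (s≤s (s≤s z≤n))
      long (snoc (snoc _ _ _) e f) g = s≤s (s≤s (s≤s z≤n))

    ∈-closed⁻ : (A : Arm b y S) (e : y ~ b) → x ∈ vertices (toWalk A e) → x ∈ b ∷ S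
    ∈-closed⁻ {b} {S = S} {x = x} A e i with ∈-++⁻ (b ∷ S) (subst (x ∈_) (vertices-toWalk A e) i)
    ... | inj₁ j           = j
    ... | inj₂ (here refl) = here refl

    ∈-walk : (A : Arm x y S) (e : y ~ z) → v ∈ z ∷ S → v ∈ vertices (toWalk A e)
    ∈-walk {v = v} A e i = subst (v ∈_) (sym (vertices-toWalk A e)) (∈-++⁺ˡ i)

    first-step : (A : Arm b y S) (e : y ~ z) → ∃[ v ] (z , v) ∈ steps (toWalk A e)
    first-step stop         e = _ , here refl
    first-step (snoc _ _ _) _ = _ , here refl

    -- The path avoids each of the cycles, but the cycles may meet each other, as those from a K₄
    -- do.
    module _ {a b y y₁ y₂ : Vertex} {S S₁ S₂ : List Vertex}
             (P : Arm a y S) (e : y ~ b) (C₁ : Arm a y₁ S₁) (e₁ : y₁ ~ a)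
             (C₂ : Arm b y₂ S₂) (e₂ : y₂ ~ b)
             (P-along : Along M (b ∷ S ++ a ∷ [])) (along₁ : Along M S₁) (along₂ : Along M S₂)
             (unique₁ : Unique ((b ∷ S ++ a ∷ []) ++ S₁))
             (unique₂ : Unique ((b ∷ S ++ a ∷ []) ++ S₂))
             where

      private
        path : List Vertex
        path = b ∷ S ++ a ∷ []

        a∈ : a ∈ path
        a∈ = there (∈-++⁺ʳ S (here refl))

        off₁ : v ∈ path → v ∉ S₁
        off₁ = unique-disjoint path unique₁

        off₂ : v ∈ path → v ∉ S₂
        off₂ = unique-disjoint path unique₂

        suffix : ∀ S {T : List Vertex} → Unique (S ++ T) → Unique T
        suffix []      U       = U
        suffix (_ ∷ S) (_ ∷ U) = suffix S U

        prefix : Unique path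
        prefix = suffix S₁ (unique-resp (++-comm path S₁) unique₁)

        with-end : ∀ {v : Vertex} {S} → v ∉ S → Unique S → Unique (v ∷ S)
        with-end {S = T} v∉ U = All.tabulate (λ i v≡w → v∉ (subst (_∈ T) (sym v≡w) i)) ∷ U

        blossom₁ blossom₂ : Blossom matched
        blossom₁ = closed-walk C₁ e₁ along₁ (with-end (off₁ a∈) (suffix path unique₁))
                     (off₁ (along-mate M P-along a∈))
        blossom₂ = closed-walk C₂ e₂ along₂ (with-end (off₂ (here refl)) (suffix path unique₂))
                     (off₂ (along-mate M P-along (here refl)))

        base : ∀ {c y T} (C : Arm c y T) (f : y ~ c) → c ∈ path → (∀ {v} → v ∈ path → v ∉ T) →
          ∀ x → x ∈ vertices (toWalk C f) → mate M c ≢ x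
        base {c} C f c∈ off x i refl with ∈-closed⁻ C f i
        ... | here m≡c = ~-irrefl (sym m≡c) (mate-edge M c)
        ... | there j  = off (along-mate M P-along c∈) j

        ∈-path⁻ : v ∈ vertices (toWalk P e) → v ∈ path
        ∈-path⁻ = subst (_ ∈_) (vertices-toWalk P e)

        avoid : ∀ {c y T} (C : Arm c y T) (f : y ~ c) → (∀ {v} → v ∈ path → v ∉ T) →
          ∀ {x} → x ∈ path → x ≢ c → x ∉ vertices (toWalk C f)
        avoid C f off i x≢c j with ∈-closed⁻ C f j
        ... | here x≡c = x≢c x≡c
        ... | there k  = off i k

        b≢a : b ≢ a
        b≢a refl with prefix
        ... | b∉ ∷ _ = All.lookup b∉ (∈-++⁺ʳ S (here refl)) refl

        -- The base `b` of one blossom lies on the path, hence not on the other blossom.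
        differ : ¬ SameBlossom matched blossom₂ blossom₁
        differ same with first-step C₂ e₂
        ... | v , i with Equivalence.to (same b v) (inj₁ i)
        ...   | inj₁ j = avoid C₁ e₁ off₁ (here refl) b≢a (proj₁ (step-ends (toWalk C₁ e₁) j))
        ...   | inj₂ j = avoid C₁ e₁ off₁ (here refl) b≢a (proj₂ (step-ends (toWalk C₁ e₁) j))

      tposy : Tposy matched
      tposy = record
        -- `toWalk P e` runs from `b` to `a`, so the blossom at `b` comes first.
        { B₁ = blossom₂ ; B₂ = blossom₁ ; distinct = differ
        ; base₁ = ∈-walk C₂ e₂ (here refl) , base C₂ e₂ (here refl) off₂
        ; base₂ = ∈-walk C₁ e₁ (here refl) , base C₁ e₁ a∈ off₁
        ; path = toWalk P e
        ; isPath = subst Unique (sym (vertices-toWalk P e)) prefix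
        ; odd = half P , length-toWalk P e
        ; mmAlternating = mm-toWalk P e P-along prefix
        ; internallyDisjoint = λ x i x≢b x≢a →
            avoid C₂ e₂ off₂ (∈-path⁻ i) x≢b , avoid C₁ e₁ off₁ (∈-path⁻ i) x≢a
        }

      tposy-contains : v ∈ path ++ S₁ ++ S₂ → Tposy.Contains tposy v
      tposy-contains i with ∈-++⁻ path i
      ... | inj₁ j = inj₂ (inj₂ (subst (_ ∈_) (sym (vertices-toWalk P e)) j))
      ... | inj₂ j with ∈-++⁻ S₁ j
      ...   | inj₁ k = inj₂ (inj₁ (∈-walk C₁ e₁ (there k)))
      ...   | inj₂ k = inj₁ (∈-walk C₂ e₂ (there k))

  path-adj : Arm x y S → y ~ z → Adj (z ∷ S ++ x ∷ [])
  path-adj stop         e = pair (~-sym e) []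
  path-adj (snoc A e f) g = pair (~-sym g) (path-adj A e)

  path-arm : Arm x y S → y ~ z → w ~ x → Arm w z (z ∷ S ++ x ∷ [])
  path-arm stop         e f = snoc stop f e
  path-arm (snoc A e g) h f = snoc (path-arm A e f) g h

  Conclusion : Vertex → Set₁
  Conclusion v = Σ (Matching G) λ M → IsMaximum G M × Σ (Tposy M) λ T → Tposy.Contains T v

  -- Each cycle comes with its own leftover, `K` or `R`, so the cycles may share vertices.
  -- `restrict` shows that one pairing of `L` restricts to the path and to both cycles.
  realise : Arm a y S → y ~ b → Arm a z S₁ → z ~ a → Arm b w S₂ → w ~ b →
    Adj T → T ↭ L → Part L →
    (∀ M → Along M T → Along M (b ∷ S ++ a ∷ []) × Along M S₁ × Along M S₂) →
    (b ∷ S ++ a ∷ []) ++ S₁ ++ K ↭ L → (b ∷ S ++ a ∷ []) ++ S₂ ++ R ↭ L →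
    v ∈ (b ∷ S ++ a ∷ []) ++ S₁ ++ S₂ → Conclusion v
  realise {a} {S = S} {b} {S₁ = S₁} {S₂ = S₂} P e C e₁ D e₂ A p part restrict q₁ q₂ i
    with part-matching A p part
  ... | M , along , _ = conclude (restrict M along)
    where
    unique : ∀ {S₁ K} → (b ∷ S ++ a ∷ []) ++ S₁ ++ K ↭ _ → Unique ((b ∷ S ++ a ∷ []) ++ S₁)
    unique {S₁} {K} q = unique-prefix ((b ∷ S ++ a ∷ []) ++ S₁)
      (unique-resp (↭-sym (↭-trans (++-assoc (b ∷ S ++ a ∷ []) S₁ K) q)) (part-unique part))
    conclude : Along M (b ∷ S ++ a ∷ []) × Along M S₁ × Along M S₂ → Conclusion _
    conclude (B , B₁ , B₂) = asMatching M , perfect-maximum M ,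
      tposy M P e C e₁ D e₂ B B₁ B₂ (unique q₁) (unique q₂) ,
      tposy-contains M P e C e₁ D e₂ B B₁ B₂ (unique q₁) (unique q₂) i

  barbell-tposy : Odd a b P → Odd a a C → Odd b b D → a ∷ b ∷ P ++ C ++ D ↭ L → Part L → v ∈ L →
    Conclusion v
  barbell-tposy {a} {b} {P} {C} {D} {L} (_ , P′ , PA , Pe , Pp) (_ , C′ , CA , Ce , Cp)
                (_ , D′ , DA , De , Dp) p part v∈L =
    realise PA Pe CA Ce DA De (adj-++ (path-adj PA Pe) (adj-++ (arm-adj CA) (arm-adj DA)))
      total part restrict total
      (↭-trans (++⁺ˡ Path (++-comm D′ C′)) total)
      (∈-resp-↭ (↭-sym total) v∈L)
    where
    Path : List Vertex
    Path = b ∷ P′ ++ a ∷ []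
    total : Path ++ C′ ++ D′ ↭ L
    total = ↭-trans (exchange (++⁺ Pp (++⁺ Cp Dp)) (solve 8 (λ a b P C D P′ C′ D′ →
        (P ⊕ C ⊕ D) ⊕ (b ⊕ P′ ⊕ a) ⊕ C′ ⊕ D′ ⊜ (P′ ⊕ C′ ⊕ D′) ⊕ a ⊕ b ⊕ P ⊕ C ⊕ D)
      refl [ a ] [ b ] P C D P′ C′ D′)) p
    restrict : ∀ M → Along M (Path ++ C′ ++ D′) → Along M Path × Along M C′ × Along M D′
    restrict M B with along-++⁻ M (path-adj PA Pe) B
    ... | B₀ , B′ = B₀ , along-++⁻ M (arm-adj CA) B′

  -- The matching covers the paths `a`-`b` and `c`-`d` with their ends, and of the other four only
  -- the inner vertices. So the triangles `a`, `c`, `d` and `b`, `c`, `d` are blossoms based at `a`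
  -- and `b`, with the path `c`-`d` in common.
  k4-tposy : Odd a b P → Odd a c ac → Odd d a ad → Odd b c bc → Odd d b bd → Odd c d cd →
    a ∷ b ∷ c ∷ d ∷ P ++ ac ++ ad ++ bc ++ bd ++ cd ↭ L → Part L → v ∈ L → Conclusion v
  k4-tposy {a} {b} {P} {c} {ac} {d} {ad} {bc} {bd} {cd} {L} {v}
           (_ , P′ , PA , Pe , Pp) (_ , S₁ , A₁ , e₁ , p₁) (_ , S₂ , A₂ , e₂ , p₂)
           (_ , S₃ , A₃ , e₃ , p₃) (_ , S₄ , A₄ , e₄ , p₄) (_ , S₅ , A₅ , e₅ , p₅) p part v∈L =
    realise PA Pe (arm-++ (arm-++ A₁ (path-arm A₅ e₅ e₁)) A₂) e₂
                  (arm-++ (arm-++ A₃ (path-arm A₅ e₅ e₃)) A₄) e₄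
      pairing total part restrict
      (↭-trans (solve 6 (λ P Q S₁ S₂ S₃ S₄ →
          P ⊕ (S₂ ⊕ Q ⊕ S₁) ⊕ (S₃ ⊕ S₄) ⊜ P ⊕ Q ⊕ S₁ ⊕ S₂ ⊕ S₃ ⊕ S₄)
        refl Path Middle S₁ S₂ S₃ S₄) total)
      (↭-trans (solve 6 (λ P Q S₁ S₂ S₃ S₄ →
          P ⊕ (S₄ ⊕ Q ⊕ S₃) ⊕ (S₁ ⊕ S₂) ⊜ P ⊕ Q ⊕ S₁ ⊕ S₂ ⊕ S₃ ⊕ S₄)
        refl Path Middle S₁ S₂ S₃ S₄) total)
      inside
    where
    Path Middle : List Vertex
    Path   = b ∷ P′ ++ a ∷ []
    Middle = d ∷ S₅ ++ c ∷ []
    Whole : List Vertex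
    Whole = Path ++ Middle ++ S₁ ++ S₂ ++ S₃ ++ S₄
    pairing : Adj Whole
    pairing = adj-++ (path-adj PA Pe) (adj-++ (path-adj A₅ e₅)
      (adj-++ (arm-adj A₁) (adj-++ (arm-adj A₂) (adj-++ (arm-adj A₃) (arm-adj A₄)))))
    total : Whole ↭ L
    total = ↭-trans (exchange (++⁺ Pp (++⁺ p₁ (++⁺ p₂ (++⁺ p₃ (++⁺ p₄ p₅)))))
      (solve 16 (λ a b c d P ac ad bc bd cd P′ S₁ S₂ S₃ S₄ S₅ →
          (P ⊕ ac ⊕ ad ⊕ bc ⊕ bd ⊕ cd) ⊕ (b ⊕ P′ ⊕ a) ⊕ (d ⊕ S₅ ⊕ c) ⊕ S₁ ⊕ S₂ ⊕ S₃ ⊕ S₄ ⊜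
          (P′ ⊕ S₁ ⊕ S₂ ⊕ S₃ ⊕ S₄ ⊕ S₅) ⊕ a ⊕ b ⊕ c ⊕ d ⊕ P ⊕ ac ⊕ ad ⊕ bc ⊕ bd ⊕ cd)
        refl [ a ] [ b ] [ c ] [ d ] P ac ad bc bd cd P′ S₁ S₂ S₃ S₄ S₅)) p
    restrict : ∀ M → Along M Whole →
      Along M Path × Along M (S₂ ++ Middle ++ S₁) × Along M (S₄ ++ Middle ++ S₃)
    restrict M B with along-++⁻ M (path-adj PA Pe) B
    ... | B₀ , B′ with along-++⁻ M (path-adj A₅ e₅) B′
    ...   | B₅ , B″ with along-++⁻ M (arm-adj A₁) B″
    ...     | B₁ , B‴ with along-++⁻ M (arm-adj A₂) B‴
    ...       | B₂ , B⁗ with along-++⁻ M (arm-adj A₃) B⁗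
    ...         | B₃ , B₄ = B₀ , along-++ M B₂ (along-++ M B₅ B₁) , along-++ M B₄ (along-++ M B₅ B₃)
    inside : v ∈ Path ++ (S₂ ++ Middle ++ S₁) ++ (S₄ ++ Middle ++ S₃)
    inside = ∈-resp-↭
      (solve 6 (λ P Q S₁ S₂ S₃ S₄ →
          (P ⊕ Q ⊕ S₁ ⊕ S₂ ⊕ S₃ ⊕ S₄) ⊕ Q ⊜ P ⊕ (S₂ ⊕ Q ⊕ S₁) ⊕ (S₄ ⊕ Q ⊕ S₃))
        refl Path Middle S₁ S₂ S₃ S₄)
      (∈-++⁺ˡ (∈-resp-↭ (↭-sym total) v∈L))

  covered-tposy : Covered v → Conclusion v
  covered-tposy (L , (a , b , P , F , path , barbell near far , p) , part , v∈L) =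
    barbell-tposy path near far p part v∈L
  covered-tposy (L , (a , b , P , F , path ,
      k4 {c} {ac} {d} {ad} {bc} {bd} {cd} Pac Pad Pbc Pbd Pcd , p) , part , v∈L) =
    k4-tposy path Pac (odd-sym Pad) Pbc (odd-sym Pbd) Pcd
      (↭-trans (solve 10 (λ a b c d P ac ad bc bd cd →
          a ⊕ b ⊕ c ⊕ d ⊕ P ⊕ ac ⊕ ad ⊕ bc ⊕ bd ⊕ cd ⊜
          a ⊕ b ⊕ P ⊕ c ⊕ d ⊕ ac ⊕ ad ⊕ bc ⊕ bd ⊕ cd)
        refl [ a ] [ b ] [ c ] [ d ] P ac ad bc bd cd) p)
      part v∈L

  open Blossom using (cycle)

  -- Strong connectivity of Jposy-graphs

  steps-◅◅ : (P : Walk u v) (Q : Walk v w) → steps (P ◅◅ Q) ≡ steps P ++ steps Q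
  steps-◅◅ ε       Q = refl
  steps-◅◅ (_ ◅ P) Q = cong (_ ∷_) (steps-◅◅ P Q)

  start∈ : (P : Walk u v) → u ∈ vertices P
  start∈ ε       = here refl
  start∈ (_ ◅ _) = here refl

  ∈-◅◅⁻ : (P : Walk u v) (Q : Walk v w) → x ∈ vertices (P ◅◅ Q) → x ∈ vertices P ⊎ x ∈ vertices Q
  ∈-◅◅⁻ ε       Q i           = inj₂ i
  ∈-◅◅⁻ (_ ◅ P) Q (here refl) = inj₁ (here refl)
  ∈-◅◅⁻ (_ ◅ P) Q (there i) with ∈-◅◅⁻ P Q i
  ... | inj₁ j = inj₁ (there j)
  ... | inj₂ j = inj₂ j

  ∈-◅◅⁺ˡ : (P : Walk u v) (Q : Walk v w) → x ∈ vertices P → x ∈ vertices (P ◅◅ Q)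
  ∈-◅◅⁺ˡ ε       Q (here refl) = start∈ Q
  ∈-◅◅⁺ˡ (_ ◅ P) Q (here refl) = here refl
  ∈-◅◅⁺ˡ (_ ◅ P) Q (there i)   = there (∈-◅◅⁺ˡ P Q i)

  ∈-◅◅⁺ʳ : (P : Walk u v) (Q : Walk v w) → x ∈ vertices Q → x ∈ vertices (P ◅◅ Q)
  ∈-◅◅⁺ʳ ε       Q i = i
  ∈-◅◅⁺ʳ (_ ◅ P) Q i = there (∈-◅◅⁺ʳ P Q i)

  split-walk : (P : Walk u v) → b ∈ vertices P → Σ (Walk u b) λ Q → Σ (Walk b v) λ R → P ≡ Q ◅◅ R
  split-walk ε       (here refl) = ε , ε , refl
  split-walk (e ◅ P) (here refl) = ε , e ◅ P , refl
  split-walk (e ◅ P) (there i) with split-walk P i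
  ... | Q , R , refl = e ◅ Q , R , refl

  source∈ : (P : Walk u v) → x ∈ map proj₁ (steps P) → x ∈ vertices P
  source∈ (_ ◅ P) (here refl) = here refl
  source∈ (_ ◅ P) (there i)   = there (source∈ P i)

  perfect : (M : Matching G) → IsPerfect G M → PerfectMatching
  perfect M total = record
    { mate      = λ u → proj₁ (total u)
    ; mate-edge = λ u → isEdge (proj₂ (total u))
    ; mate-mate = λ u → functional (proj₂ (total (proj₁ (total u)))) (symmetric (proj₂ (total u)))
    }
    where open Matching M

  module _ (M : Matching G) (total : IsPerfect G M) where
    open Matching M

    private
      N : PerfectMatching
      N = perfect M total

    mate-matched : Matched u v → mate N u ≡ v
    mate-matched {u} m = functional (proj₂ (total u)) m

    infix 4 _⇒_
    _⇒_ : Vertex → Vertex → Set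
    _⇒_ = Star (Arc N)

    arc-to-mate : p ~ u → Arc N p (mate N u)
    arc-to-mate {p} e = subst (p ~_) (sym (mate-mate N _)) e

    arc-across : p ~ u → Matched u v → Arc N p v
    arc-across {p} e m = subst (p ~_) (sym (mate-matched (symmetric m))) e

    -- An arc from `x` to `y` is an edge from `x` to the mate of `y`; read backwards it is an arc
    -- from the mate of `y` to the mate of `x`.
    skew : x ⇒ y → mate N y ⇒ mate N x
    skew ε       = ε
    skew (a ◅ P) = skew P ◅◅ (arc-to-mate (~-sym a) ◅ ε)

    -- A directed path following a walk meets, of each matched edge, only one end; the other vertex
    -- counts as visited through its mate.
    Through : Vertex → Vertex → Vertex → Set
    Through p x q = (p ⇒ x × x ⇒ q) ⊎ (p ⇒ mate N x × mate N x ⇒ q)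

    through-prepend : p ⇒ y → Through y x q → Through p x q
    through-prepend P (inj₁ (Q , R)) = inj₁ (P ◅◅ Q , R)
    through-prepend P (inj₂ (Q , R)) = inj₂ (P ◅◅ Q , R)

    joins? : (e : Vertex × Vertex) → Dec (InM M e)
    joins? (u , v) = matched? u v

    count : Walk u v → ℕ
    count P = length (filter joins? (steps P))

    data Alternate {b : Vertex} : Walk u b → Set where
      []  : Alternate ε
      _∷_ : {e : u ~ v} {f : v ~ w} {P : Walk w b} → Matched u v × ¬ Matched v w → Alternate P →
            Alternate (e ◅ f ◅ P)

    count-matched : (e : u ~ v) (P : Walk v w) → Matched u v → count (e ◅ P) ≡ suc (count P)
    count-matched {u} {v} e P m = cong length (filter-accept joins? {x = u , v} {xs = steps P} m)

    count-unmatched : (e : u ~ v) (P : Walk v w) → ¬ Matched u v → count (e ◅ P) ≡ count P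
    count-unmatched {u} {v} e P n = cong length (filter-reject joins? {x = u , v} {xs = steps P} n)

    consecutive : (P : Walk x b) → All (u ≢_) (v ∷ map proj₁ (steps P)) → ¬ Matched v b →
      Matched u v → ¬ Matched v x
    consecutive ε       _            free _ n = free n
    consecutive (_ ◅ _) (_ ∷ u≢ ∷ _) _    m n = u≢ (functional (symmetric m) n)

    -- Among any two consecutive edges at most one is matched, and the last edge is
    -- not; if half of the edges are matched, it is thus every other one.
    alternate : (P : Walk u b) (j : ℕ) → ∣ P ∣ ≡ 2 * j → j ≤ count P →
      Unique (map proj₁ (steps P)) → (∀ {v} → v ∈ map proj₁ (steps P) → ¬ Matched v b) →
      Alternate P × count P ≤ j
    alternate ε       zero    _ _ _ _ = [] , z≤n
    alternate (e ◅ ε) (suc j) l _ _ _ with suc-injective (trans l (*-suc 2 j))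
    ... | ()
    alternate {b = b} (_◅_ {u} {v} e (_◅_ {j = x} f P)) (suc j) l c (u∉ ∷ v∉ ∷ U) free =
      decide (matched? u v) (matched? v x)
      where
      l′ : ∣ P ∣ ≡ 2 * j
      l′ = suc-injective (suc-injective (trans l (*-suc 2 j)))
      rest : j ≤ count P → Alternate P × count P ≤ j
      rest c′ = alternate P j l′ c′ U (λ i → free (there (there i)))
      one-matched : count (e ◅ f ◅ P) ≡ suc (count P) → j ≤ count P
      one-matched q = s≤s⁻¹ (subst (suc j ≤_) q c)
      excluded : Matched v x → (P : Walk x b) → All (v ≢_) (map proj₁ (steps P)) →
        (∀ {v′} → v′ ∈ v ∷ map proj₁ (steps P) → ¬ Matched v′ b) → ¬ Alternate P
      excluded n ε       _  free [] = free (here refl) n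
      excluded n (g ◅ h ◅ Q) v∉ free ((m , _) ∷ _) =
        consecutive (h ◅ Q) v∉ (free (there (here refl))) n m
      decide : Dec (Matched u v) → Dec (Matched v x) →
        Alternate (e ◅ f ◅ P) × count (e ◅ f ◅ P) ≤ suc j
      decide (yes m) (yes n) = ⊥-elim (consecutive P u∉ (free (there (here refl))) m n)
      decide (yes m) (no n)
        with trans (count-matched e (f ◅ P) m) (cong suc (count-unmatched f P n))
      ... | one with rest (one-matched one)
      ...   | A , c′ = (m , n) ∷ A , subst (_≤ suc j) (sym one) (s≤s c′)
      decide (no m) (yes n)
        with rest (one-matched (trans (count-unmatched e (f ◅ P) m) (count-matched f P n)))
      ... | A , _ = ⊥-elim (excluded n P v∉ (λ i → free (there i)) A)
      decide (no m) (no n) =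
        ⊥-elim (<-irrefl refl (≤-trans c″ (proj₂ (rest (≤-trans (n≤1+n j) c″)))))
        where
        c″ : suc j ≤ count P
        c″ = subst (suc j ≤_) (trans (count-unmatched e (f ◅ P) m) (count-unmatched f P n)) c

    -- The arc across a matched edge `u v` leads to `v`, and `u` is met as the mate of `v`. The
    -- final edge into `b` becomes an arc to the mate of `b`, so `b` itself is exceptional.
    alternate-through : {P : Walk u b} → Alternate P → p ~ u →
      p ⇒ mate N b × (∀ {x} → x ∈ vertices P → x ≡ b ⊎ Through p x (mate N b))
    alternate-through [] e = arc-to-mate e ◅ ε , λ { (here refl) → inj₁ refl }
    alternate-through {u} {b} {p} (_∷_ {v = v} {f = f} (m , _) A) e with alternate-through A f
    ... | P , through = arc-across e m ◅ P , λ
      { (here refl)         → inj₂ (inj₂ (subst (λ y → p ⇒ y × y ⇒ mate N b) (sym (mate-matched m))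
                                (arc-across e m ◅ ε , P)))
      ; (there (here refl)) → inj₂ (inj₁ (arc-across e m ◅ ε , P))
      ; (there (there i))   → later (through i)
      }
      where
      later : ∀ {x} → x ≡ b ⊎ Through v x (mate N b) → x ≡ b ⊎ Through p x (mate N b)
      later (inj₁ q) = inj₁ q
      later (inj₂ t) = inj₂ (through-prepend (arc-across e m ◅ ε) t)

    -- The cycle is rotated to start at the base. Its first edge is then unmatched, and the
    -- remaining `2k` edges contain all `k` matched ones, which forces them to alternate.
    blossom-through : (B : Blossom M) → IsBase M B b →
      b ⇒ mate N b × (∀ {x} → x ∈ vertices (cycle B) → Through b x (mate N b))
    blossom-through {b} B (b∈ , free) with split-walk (cycle B) b∈
    ... | Q , R , eq = go (R ◅◅ Q) refl
      where
      rotation : steps (R ◅◅ Q) ↭ steps (cycle B)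
      rotation = ↭-trans (↭-reflexive (steps-◅◅ R Q)) (↭-trans (++-comm (steps R) (steps Q))
        (↭-reflexive (trans (sym (steps-◅◅ Q R)) (cong steps (sym eq)))))
      ∈-rotation⁻ : x ∈ vertices (R ◅◅ Q) → x ∈ vertices (cycle B)
      ∈-rotation⁻ {x} i = subst (λ P → x ∈ vertices P) (sym eq) (both (∈-◅◅⁻ R Q i))
        where
        both : x ∈ vertices R ⊎ x ∈ vertices Q → x ∈ vertices (Q ◅◅ R)
        both (inj₁ j) = ∈-◅◅⁺ʳ Q R j
        both (inj₂ j) = ∈-◅◅⁺ˡ Q R j
      ∈-rotation⁺ : x ∈ vertices (cycle B) → x ∈ vertices (R ◅◅ Q)
      ∈-rotation⁺ {x} i with ∈-◅◅⁻ Q R (subst (λ P → x ∈ vertices P) eq i)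
      ... | inj₁ j = ∈-◅◅⁺ʳ R Q j
      ... | inj₂ j = ∈-◅◅⁺ˡ R Q j
      go : (P : Walk b b) → P ≡ R ◅◅ Q →
        b ⇒ mate N b × (∀ {x} → x ∈ vertices (cycle B) → Through b x (mate N b))
      go ε r
        with trans (↭-length (subst (λ P → steps P ↭ _) (sym r) rotation)) (Blossom.length≡ B)
      ... | ()
      go (e ◅ P) r = proj₁ through , λ i →
        at-base (proj₂ through) (subst (λ P → _ ∈ vertices P) (sym r) (∈-rotation⁺ i))
        where
        turned : steps (e ◅ P) ↭ steps (cycle B)
        turned = subst (λ P → steps P ↭ _) (sym r) rotation
        unmatched : ∀ {x} → x ∈ vertices (e ◅ P) → ¬ Matched b x
        unmatched i = free _ (∈-rotation⁻ (subst (λ P → _ ∈ vertices P) r i))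
        length≡ : ∣ P ∣ ≡ 2 * Blossom.k B
        length≡ = suc-injective (trans (↭-length turned) (Blossom.length≡ B))
        count≡ : count P ≡ Blossom.k B
        count≡ = trans (sym (count-unmatched e P (unmatched (there (start∈ P)))))
          (trans (↭-length (filter-↭ joins? turned)) (Blossom.matched≡ B))
        sources : Unique (map proj₁ (steps P))
        sources = AllPairs.tail
          (unique-resp (map⁺ proj₁ (↭-sym turned)) (proj₂ (Blossom.isCycle B)))
        through = alternate-through
          (proj₁ (alternate P (Blossom.k B) length≡ (≤-reflexive (sym count≡)) sources
            (λ i m → unmatched (there (source∈ P i)) (symmetric m)))) e
        at-base : ∀ {x} → (∀ {x} → x ∈ vertices P → x ≡ b ⊎ Through b x (mate N b)) →
          x ∈ vertices (e ◅ P) → Through b x (mate N b)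
        at-base h (here refl) = inj₁ (ε , proj₁ through)
        at-base h (there i) with h i
        ... | inj₁ refl = inj₁ (ε , proj₁ through)
        ... | inj₂ t    = t

    mm-through : (P : Walk u v) → OddLength P → MMAlternating M P →
      mate N u ⇒ v × (∀ {x} → x ∈ vertices P → Through (mate N u) x v)
    mm-through P (k , l) (alt , first , _) = go P k l alt first
      where
      go : ∀ {u v} (P : Walk u v) k → ∣ P ∣ ≡ suc (2 * k) → Alternating M P →
        AnyMaybe (InM M) (head (steps P)) →
        mate N u ⇒ v × (∀ {x} → x ∈ vertices P → Through (mate N u) x v)
      go (e ◅ ε) k l alt (just m) = subst (_⇒ _) (sym (mate-matched m)) ε , λ
        { (here refl)         → inj₂ (ε , subst (_⇒ _) (sym (mate-matched m)) ε)
        ; (there (here refl)) → inj₁ (subst (_⇒ _) (sym (mate-matched m)) ε , ε)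
        }
      go (e ◅ f ◅ ε) (suc k) l _ _ with suc-injective (trans (suc-injective l) (*-suc 2 k))
      ... | ()
      go (e ◅ f ◅ g ◅ P) (suc k) l (inj₂ (n , _) ∷ _) (just m) = ⊥-elim (n m)
      go (e ◅ f ◅ g ◅ P) (suc k) l (inj₁ (_ , n) ∷ inj₁ (m′ , _) ∷ _) (just m) = ⊥-elim (n m′)
      go {u} {v} (_◅_ {j = u₁} e (f ◅ g ◅ P)) (suc k) l (inj₁ _ ∷ inj₂ (_ , m′) ∷ alt) (just m)
        with go (g ◅ P) k (suc-injective (suc-injective (trans l (cong suc (*-suc 2 k))))) alt
               (just m′)
      ... | Q , through = whole , λ
        { (here refl)         → inj₂ (ε , whole)
        ; (there (here refl)) → inj₁ (u⇒u₁ , u₁⇒v)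
        ; (there (there i))   → through-prepend (u⇒u₁ ◅◅ arc-to-mate f ◅ ε) (through i)
        }
        where
        u⇒u₁ : mate N u ⇒ u₁
        u⇒u₁ = subst (_⇒ u₁) (sym (mate-matched m)) ε
        u₁⇒v : u₁ ⇒ v
        u₁⇒v = arc-to-mate f ◅ Q
        whole : mate N u ⇒ v
        whole = u⇒u₁ ◅◅ u₁⇒v

    jposy-strongly-connected : (J : Jposy M) → (∀ x → Jposy.Contains J x) → StronglyConnected N
    jposy-strongly-connected J contains x y = proj₂ (hub x) ◅◅ proj₁ (hub y)
      where
      open Jposy J
      loop₁ = blossom-through B₁ base₁
      loop₂ = blossom-through B₂ base₂
      across = mm-through walk odd mmAlternating
      Hub : Vertex → Set
      Hub x = b₁ ⇒ x × x ⇒ b₁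
      back : mate N b₂ ⇒ b₁
      back = subst (mate N b₂ ⇒_) (mate-mate N b₁) (skew (proj₁ across))
      hub-b₁ : Hub b₁
      hub-b₁ = ε , ε
      hub-b₁′ : Hub (mate N b₁)
      hub-b₁′ = proj₁ loop₁ , proj₁ across ◅◅ proj₁ loop₂ ◅◅ back
      hub-b₂ : Hub b₂
      hub-b₂ = proj₁ loop₁ ◅◅ proj₁ across , proj₁ loop₂ ◅◅ back
      hub-b₂′ : Hub (mate N b₂)
      hub-b₂′ = proj₁ hub-b₂ ◅◅ proj₁ loop₂ , back
      mate² : ∀ {x} → Hub x → Hub (mate N (mate N x))
      mate² {x} = subst Hub (sym (mate-mate N x))
      hub-through : ∀ {p x q} → Hub p → Hub (mate N p) → Hub q → Hub (mate N q) →
        Through p x q → Hub x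
      hub-through P _ Q _ (inj₁ (R , S)) = proj₁ P ◅◅ R , S ◅◅ proj₂ Q
      -- Here the mate of `x` is on the path; skewing both halves leads from the mate of `q` through
      -- `x` to the mate of `p`.
      hub-through {x = x} _ P _ Q (inj₂ (R , S)) =
        subst Hub (mate-mate N x) (proj₁ Q ◅◅ skew S , skew R ◅◅ proj₂ P)
      hub : ∀ x → Hub x
      hub x with contains x
      ... | inj₁ i        = hub-through hub-b₁ hub-b₁′ hub-b₁′ (mate² hub-b₁) (proj₂ loop₁ i)
      ... | inj₂ (inj₁ i) = hub-through hub-b₂ hub-b₂′ hub-b₂′ (mate² hub-b₂) (proj₂ loop₂ i)
      ... | inj₂ (inj₂ i) = hub-through hub-b₁′ (mate² hub-b₁) hub-b₂ hub-b₂′ (proj₂ across i)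

theorem5p6 : (G : Graph) → IsJposyGraph G → (v : Graph.Vertex G) →
    Σ (Matching G) λ M → IsMaximum G M × Σ (Tposy M) λ T → Tposy.Contains T v
theorem5p6 G (M , total , J , contains , _) v =
  covered-tposy G
    (all-covered G (perfect G M total) (jposy-strongly-connected G M total J contains) v)
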